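{- Let $L \subseteq \mathbb{N}$ be an infinite set with lower density zero. For all $t, s \in \mathbb{N}$ there exists a planar graph $G$ such that (1) for every collection of $t$ $L$-cycles in $G$, there is a vertex lying in all of them, and (2) for every $S \subseteq V(G)$ with $|S| \leq s$, the graph $G - S$ contains an $L$-cycle.
   Context: $\mathbb{N}$ denotes the set of positive integers. Graphs are finite. For $L \subseteq \mathbb{N}$, an $L$-cycle is a cycle whose length (number of edges) lies in $L$. The lower density of $L$ is $\underline{d}(L) := \liminf_{n\to\infty} \frac{|L \cap \{1,\dots,n\}|}{n}$. -}

module Defs where

open import Data.Nat as ℕ using (ℕ; zero; suc)
open import Data.Bool using (Bool; true; false)
open import Data.Fin as Fin using (Fin; toℕ)
open import Data.Fin.Subset using (Subset; _∈_; _∉_; ∣_∣)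
open import Data.List using (List; []; _∷_; _++_; length; lookup)
open import Data.Product using (Σ; ∃; ∃-syntax; _×_; _,_; proj₁; proj₂)
open import Data.Sum using (_⊎_)
open import Data.Empty using (⊥)
open import Relation.Nullary using (¬_)
open import Relation.Binary.PropositionalEquality using (_≡_)
open import Data.Rational as ℚ using (ℚ; 0ℚ; 1ℚ)

data Count (L : ℕ → Set) : ℕ → ℕ → Set where
  c-zero : Count L 0 0
  c-in   : ∀ {n k} → L (suc n) → Count L n k → Count L (suc n) (suc k)
  c-out  : ∀ {n k} → ¬ L (suc n) → Count L n k → Count L (suc n) k

Infinite : (ℕ → Set) → Set
Infinite L = ∀ N → ∃[ m ] (N ℕ.≤ m × L m)

-- liminf_{n→∞} |L ∩ [1,n]| / n = 0, i.e. (since the ratios are ≥ 0)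
-- for every ε = 1/(q+1) > 0 and every N there is n ≥ N with |L∩[1,n]|/n < ε.
LowerDensityZero : (ℕ → Set) → Set
LowerDensityZero L =
  ∀ (q N : ℕ) → ∃[ n ] (N ℕ.≤ n × ∃[ k ] (Count L n k × suc q ℕ.* k ℕ.< n))

record Graph : Set where
  field
    n      : ℕ
    Adj    : Fin n → Fin n → Bool
    sym    : ∀ u v → Adj u v ≡ Adj v u
    irrefl : ∀ v → Adj v v ≡ false

module _ (G : Graph) where
  open Graph G

  record Cycle : Set where
    field
      len   : ℕ
      len≥3 : 3 ℕ.≤ len
      vert  : Fin len → Fin n
      inj   : ∀ i j → vert i ≡ vert j → i ≡ j
      adj   : ∀ (i j : Fin len) →
              (suc (toℕ i) ≡ toℕ j) ⊎ (suc (toℕ i) ≡ len × toℕ j ≡ 0) →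
              Adj (vert i) (vert j) ≡ true

  OnCycle : Fin n → Cycle → Set
  OnCycle v C = ∃[ i ] (Cycle.vert C i ≡ v)

  LCycle : (ℕ → Set) → Set
  LCycle L = Σ Cycle (λ C → L (Cycle.len C))

-- Planarity (polygonal drawings, as in Diestel's definition of plane graphs)

Point : Set
Point = ℚ × ℚ

OnSeg : Point → Point × Point → Set
OnSeg (px , py) ((ax , ay) , (bx , by)) =
  Σ ℚ λ λ′ → (0ℚ ℚ.≤ λ′) × (λ′ ℚ.≤ 1ℚ) ×
    (px ≡ ax ℚ.+ λ′ ℚ.* (bx ℚ.- ax)) × (py ≡ ay ℚ.+ λ′ ℚ.* (by ℚ.- ay))

segments : List Point → List (Point × Point)
segments []            = []
segments (a ∷ [])      = []
segments (a ∷ b ∷ ps)  = (a , b) ∷ segments (b ∷ ps)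

OnPath : Point → List Point → Set
OnPath p []           = ⊥
OnPath p (a ∷ [])     = p ≡ a
OnPath p (a ∷ b ∷ ps) = OnSeg p (a , b) ⊎ OnPath p (b ∷ ps)

SimplePath : List Point → Set
SimplePath ps =
  ∀ (i j : Fin (length (segments ps))) → toℕ i ℕ.< toℕ j → ∀ p →
    OnSeg p (lookup (segments ps) i) → OnSeg p (lookup (segments ps) j) →
    (toℕ j ≡ suc (toℕ i)) × (p ≡ proj₂ (lookup (segments ps) i))

module _ (G : Graph) where
  open Graph G

  Edge : Set
  Edge = Σ (Fin n × Fin n) λ e → (proj₁ e Fin.< proj₂ e) × (Adj (proj₁ e) (proj₂ e) ≡ true)

  Endpoint : Fin n → Edge → Set
  Endpoint w ((u , v) , _) = (w ≡ u) ⊎ (w ≡ v)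

  record PlaneDrawing : Set where
    field
      pos   : Fin n → Point
      bends : Fin n → Fin n → List Point
    arc : Edge → List Point
    arc ((u , v) , _) = pos u ∷ (bends u v ++ (pos v ∷ []))
    field
      pos-inj  : ∀ u v → pos u ≡ pos v → u ≡ v
      arc-simple : ∀ e → SimplePath (arc e)
      no-vertex-inside : ∀ e w → OnPath (pos w) (arc e) → Endpoint w e
      arcs-disjoint : ∀ e f → ¬ (proj₁ e ≡ proj₁ f) → ∀ p →
        OnPath p (arc e) → OnPath p (arc f) →
        ∃[ w ] (p ≡ pos w × Endpoint w e × Endpoint w f)

  Planar : Set
  Planar = PlaneDrawing

{-# OPTIONS --safe #-}
module Submission where

-- Take a grid with rows 0, …, R = 2s + 2 whose top row R keeps only M = a + s "heavy" edges, one for each of M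
-- consecutive units of κ columns.  Subdivide heavy edges into x pieces and all others into y pieces, x being much
-- larger than y.  Every cycle then has length α x + β y with bounded α and β.
--
-- After deleting s vertices, one of the s + 1 strips between rows 2q and 2q + 1 is intact, and so are a of the
-- units.  The boundary of that strip, enlarged by a full-height column of cells in each of these a units, is a
-- cycle through exactly a heavy edges, and its length ℓ = a x + c y does not depend on q or on the units.
--
-- Since c ≡ 1 mod a, for a given ℓ ∈ L the solutions (x , y) of a x + c y = ℓ form a long arithmetic progression,
-- along which every other length α x + β y < ℓ is injective.  If L is sparse below ℓ, some solution makes all
-- these lengths avoid L.  Then every L-cycle has length at least ℓ, and as M ≈ a it misses fewer than n / t of the
-- n vertices, so any t of them have a common vertex.

open import Defs
open import Data.Nat as ℕ using (ℕ; zero; suc; _+_; _*_; _∸_; _≤_; _<_; z≤n; s≤s; _<?_; _/_; _%_; NonZero; >-nonZero; >-nonZero⁻¹)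
open import Data.Nat.Properties hiding (_≟_)
open import Data.Nat.Coprimality as Coprimality using (1-coprimeTo)
open import Data.Nat.Divisibility using (divides; ∣m+n∣m⇒∣n)
open import Data.Nat.DivMod using (m≡m%n+[m/n]*n; m%n<n; m*n/n≡m; /-mono-≤; m<n*o⇒m/o<n)
open import Data.Nat.ListAction using (sum)
open import Data.Nat.ListAction.Properties using (sum-++)
open import Data.Nat.Tactic.RingSolver using (solve-∀)
import Data.Integer as ℤ
import Data.Integer.Properties as ℤₚ
open import Data.Rational as ℚ using (ℚ; mkℚ; 0ℚ; 1ℚ; *≤*)
import Data.Rational.Properties as ℚₚ
import Data.Rational.Solver as ℚSolver
open import Data.Bool using (Bool; true; false; not; if_then_else_)
open import Data.Fin as Fin using (Fin; zero; suc; toℕ; fromℕ; fromℕ<; inject₁)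
import Data.Fin.Properties as Finₚ
open import Data.Fin.Subset using (Subset; _∉_; ∣_∣) renaming (_∈_ to _∈ₛ_; ⊥ to ∅)
open import Data.Fin.Subset.Properties using (∣⊥∣≡0)
open import Data.Vec using (here; there; []; _∷_)
open import Data.List using (List; []; _∷_; _++_; length; map; filter; concat; concatMap; cartesianProduct; cartesianProductWith; tabulate; allFin; upTo; lookup; deduplicate)
open import Data.List.Properties using (length-++; length-map; length-tabulate; length-upTo; length-filter; map-++; filter-++)
open import Data.List.Membership.Propositional using (_∈_; find; lose) renaming (_∉_ to _∉ˡ_)
open import Data.List.Membership.Propositional.Properties
  using ( ∈-∃++; ∈-++⁺ˡ; ∈-++⁺ʳ; ∈-++⁻; ∈-map⁺; ∈-map⁻; ∈-filter⁺; ∈-filter⁻; ∈-tabulate⁺; ∈-tabulate⁻; ∈-allFin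
        ; ∈-upTo⁺; ∈-upTo⁻; ∈-concat⁺′; ∈-concatMap⁺; ∈-concatMap⁻; ∈-cartesianProduct⁺; ∈-cartesianProductWith⁺
        ; ∈-cartesianProductWith⁻; ∈-deduplicate⁺; ∈-deduplicate⁻; ∈-lookup)
import Data.List.Membership.DecPropositional as DecMembership
open import Data.List.Relation.Unary.All as All using (All; []; _∷_)
import Data.List.Relation.Unary.All.Properties as Allₚ
open import Data.List.Relation.Unary.AllPairs as AllPairs using (AllPairs; []; _∷_)
import Data.List.Relation.Unary.AllPairs.Properties as AllPairsₚ
open import Data.List.Relation.Unary.Any as Any using (Any; here; there; any?)
open import Data.List.Relation.Unary.Any.Properties using (lookup-index)
open import Data.List.Relation.Unary.Unique.Propositional using (Unique)
import Data.List.Relation.Unary.Unique.Propositional.Properties as Uniqueₚ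
open import Data.List.Relation.Unary.Unique.DecPropositional.Properties using (deduplicate-!)
open import Data.Product using (Σ; ∃-syntax; _×_; _,_; proj₁; proj₂)
open import Data.Product.Properties using (≡-dec; ,-injective; ,-injectiveʳ)
open import Data.Sum using (_⊎_; inj₁; inj₂)
open import Data.Unit using (⊤; tt)
open import Data.Empty using (⊥; ⊥-elim)
open import Function using (_∘_; case_of_)
open import Relation.Unary using (Decidable)
open import Relation.Nullary using (¬_; Dec; yes; no; does; ¬?; _×-dec_; _⊎-dec_)
open import Relation.Nullary.Decidable using (decidable-stable; dec-true; dec-false; map′)
open import Relation.Binary.Definitions using (DecidableEquality; tri<; tri≈; tri>)
open import Relation.Binary.PropositionalEquality using (_≡_; _≢_; refl; sym; trans; cong; cong₂; subst; subst₂; module ≡-Reasoning)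

open DecMembership ℕ._≟_ using (_∈?_)

-- Counting with duplicate-free lists

-- The danger is a coincidence: a pair (α , β) whose length stays constant along the line a x + c y
-- = ℓ and happens to lie in `L`, so that no choice on the line repairs it. Such pairs are
-- proportional to (a , c). If a and c are coprime, they are the multiples m (a , c), of length m ℓ,
-- hence never strictly between 0 and ℓ. This is why c ≡ 1 mod a is arranged. The congruence comes
-- from a = 2 κ s + 1. The s units that the cycle merely passes through cost 2 κ light edges each, a
-- - 1 altogether; the two ends of the strip cost 2; everything else comes in multiples of a. The
-- same a exceeds t s, which is why κ grows with t: a cycle of length at least ℓ misses little more
-- than s x vertices, while ℓ is at least a x. Density enters through a count. The bad points on the
-- line number at most (pairs) times (elements of `L` below ℓ), and the pairs are bounded in terms
-- of t and s alone, while the line offers a constant fraction of ℓ points.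

unique-⊆-length : ∀ {A : Set} {xs ys : List A} → Unique xs → (∀ {v} → v ∈ xs → v ∈ ys) → length xs ≤ length ys
unique-⊆-length {xs = []} _ _ = z≤n
unique-⊆-length {A} {x ∷ xs} (x∉ ∷ u) sub with ∈-∃++ (sub (here refl))
... | as , bs , refl = begin
  suc (length xs)                ≤⟨ s≤s (unique-⊆-length u sub′) ⟩
  suc (length (as ++ bs))        ≡⟨ cong suc (length-++ as) ⟩
  suc (length as + length bs)    ≡⟨ sym (+-suc (length as) (length bs)) ⟩
  length as + suc (length bs)    ≡⟨ sym (length-++ as) ⟩
  length (as ++ x ∷ bs)          ∎
  where
  open ≤-Reasoning
  sub′ : ∀ {v} → v ∈ xs → v ∈ as ++ bs
  sub′ {v} v∈ with ∈-++⁻ as (sub (there v∈))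
  ... | inj₁ v∈as = ∈-++⁺ˡ v∈as
  ... | inj₂ (here refl) = ⊥-elim (All.lookup x∉ v∈ refl)
  ... | inj₂ (there v∈bs) = ∈-++⁺ʳ as v∈bs

length-concat-tabulate : ∀ {A : Set} c {t} (f : Fin t → List A) → (∀ i → length (f i) ≤ c) →
  length (concat (tabulate f)) ≤ t * c
length-concat-tabulate c {zero} f h = z≤n
length-concat-tabulate c {suc t} f h = begin
  length (f zero ++ concat (tabulate (f ∘ suc)))        ≡⟨ length-++ (f zero) ⟩
  length (f zero) + length (concat (tabulate (f ∘ suc)))
    ≤⟨ +-mono-≤ (h zero) (length-concat-tabulate c (f ∘ suc) (h ∘ suc)) ⟩
  c + t * c ∎
  where open ≤-Reasoning

length-cartesianProduct : ∀ {A B : Set} (xs : List A) (ys : List B) →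
  length (cartesianProduct xs ys) ≡ length xs * length ys
length-cartesianProduct [] ys = refl
length-cartesianProduct (x ∷ xs) ys =
  trans (length-++ (map (x ,_) ys)) (cong₂ _+_ (length-map (x ,_) ys) (length-cartesianProduct xs ys))

length-allFin : ∀ n → length (allFin n) ≡ n
length-allFin n = length-tabulate (λ i → i)

-- Each map misses at most n ∸ ℓ points, so the maps together cannot miss all n points.
common-value : ∀ {t n ℓ} (len : Fin t → ℕ) (f : ∀ i → Fin (len i) → Fin n) →
  (∀ i j k → f i j ≡ f i k → j ≡ k) → (∀ i → ℓ ≤ len i) → t * (n ∸ ℓ) < n →
  ∃[ v ] (∀ i → ∃[ j ] f i j ≡ v)
common-value {t} {n} {ℓ} len f inj long small
  with Finₚ.any? (λ v → Finₚ.all? (λ i → Finₚ.any? (λ j → f i j Finₚ.≟ v)))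
... | yes p = p
... | no ¬p = ⊥-elim (<-irrefl refl (<-≤-trans small (begin
  n                                     ≡⟨ sym (length-allFin n) ⟩
  length (allFin n)                     ≤⟨ unique-⊆-length (Uniqueₚ.allFin⁺ n) covered ⟩
  length (concat (tabulate missed))     ≤⟨ length-concat-tabulate (n ∸ ℓ) missed missed-few ⟩
  t * (n ∸ ℓ)                           ∎)))
  where
  open ≤-Reasoning
  hit? : ∀ i v → Dec (∃[ j ] f i j ≡ v)
  hit? i v = Finₚ.any? (λ j → f i j Finₚ.≟ v)
  missed : Fin t → List (Fin n)
  missed i = filter (λ v → ¬? (hit? i v)) (allFin n)
  covered : ∀ {v} → v ∈ allFin n → v ∈ concat (tabulate missed)
  covered {v} v∈ with Finₚ.¬∀⟶∃¬ t _ (λ i → hit? i v) (λ h → ¬p (v , h))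
  ... | i , ¬hit = ∈-concat⁺′ (∈-filter⁺ (λ v → ¬? (hit? i v)) v∈ ¬hit) (∈-tabulate⁺ i)
  missed-few : ∀ i → length (missed i) ≤ n ∸ ℓ
  missed-few i = ≤-trans (m+n≤o⇒m≤o∸n (length (missed i)) (begin
    length (missed i) + len i                       ≡⟨ cong (length (missed i) +_) (sym (length-tabulate (f i))) ⟩
    length (missed i) + length (tabulate (f i))     ≡⟨ sym (length-++ (missed i)) ⟩
    length (missed i ++ tabulate (f i))
      ≤⟨ unique-⊆-length
           (Uniqueₚ.++⁺ (Uniqueₚ.filter⁺ (λ v → ¬? (hit? i v)) (Uniqueₚ.allFin⁺ n))
             (Uniqueₚ.tabulate⁺ (λ {j} {k} → inj i j k))
             (λ { (p , q) → let (j , e) = ∈-tabulate⁻ q in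
                proj₂ (∈-filter⁻ (λ v → ¬? (hit? i v)) {xs = allFin n} p) (j , sym e) }))
           (λ {v} _ → ∈-allFin v) ⟩
    length (allFin n)                               ≡⟨ length-allFin n ⟩
    n ∎)) (∸-monoʳ-≤ n (long i))

-- Sparse initial segments

module _ {L : ℕ → Set} where

  Count⇒list : ∀ {n k} → Count L n k →
    ∃[ ls ] (length ls ≡ k × (∀ v → 1 ≤ v → v ≤ n → L v → v ∈ ls))
  Count⇒list c-zero = [] , refl , λ { .0 () z≤n _ }
  Count⇒list (c-in {n} l c) with Count⇒list c
  ... | ls , eq , all = suc n ∷ ls , cong suc eq , λ v 1≤v v≤ Lv → case′ v 1≤v (m≤n⇒m<n∨m≡n v≤) Lv
    where
    case′ : ∀ v → 1 ≤ v → v < suc n ⊎ v ≡ suc n → L v → v ∈ suc n ∷ ls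
    case′ v 1≤v (inj₁ (s≤s v≤n)) Lv = there (all v 1≤v v≤n Lv)
    case′ v 1≤v (inj₂ refl) Lv = here refl
  Count⇒list (c-out {n} ¬l c) with Count⇒list c
  ... | ls , eq , all = ls , eq , λ v 1≤v v≤ Lv → case′ v 1≤v (m≤n⇒m<n∨m≡n v≤) Lv
    where
    case′ : ∀ v → 1 ≤ v → v < suc n ⊎ v ≡ suc n → L v → v ∈ ls
    case′ v 1≤v (inj₁ (s≤s v≤n)) Lv = all v 1≤v v≤n Lv
    case′ v 1≤v (inj₂ refl) Lv = ⊥-elim (¬l Lv)

  -- `L` has no decision procedure, but a `Count` derivation records a decision for every number it
  -- passes. `sparse-element` appeals to the density a second time just to get a derivation that
  -- reaches the known element m.
  Count⇒dec : ∀ {n k} → Count L n k → ∀ v → 1 ≤ v → v ≤ n → Dec (L v)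
  Count⇒dec c-zero v 1≤v v≤0 = ⊥-elim (<-irrefl refl (≤-trans 1≤v v≤0))
  Count⇒dec (c-in l c) v 1≤v v≤ with m≤n⇒m<n∨m≡n v≤
  ... | inj₁ (s≤s v≤n) = Count⇒dec c v 1≤v v≤n
  ... | inj₂ refl = yes l
  Count⇒dec (c-out ¬l c) v 1≤v v≤ with m≤n⇒m<n∨m≡n v≤
  ... | inj₁ (s≤s v≤n) = Count⇒dec c v 1≤v v≤n
  ... | inj₂ refl = no ¬l

  -- The search walks from p towards a known element at distance d. Every number rejected on the way
  -- extends the derivation by `c-out`, so the count k stays the same.
  next-element : ∀ d {p k} → Count L p k → L (d + suc p) →
    (∀ v → 1 ≤ v → v ≤ d + suc p → Dec (L v)) →
    ∃[ p′ ] (p ≤ p′ × L (suc p′) × Count L p′ k)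
  next-element zero {p} c l dec = p , ≤-refl , l , c
  next-element (suc d) {p} c l dec with dec (suc p) (s≤s z≤n) (m≤n+m (suc p) (suc d))
  ... | yes l′ = p , ≤-refl , l′ , c
  ... | no ¬l′ with next-element d (c-out ¬l′ c) (subst L eq l)
                      (λ v 1≤v v≤ → dec v 1≤v (subst (v ≤_) (sym eq) v≤))
    where
    eq : suc d + suc p ≡ d + suc (suc p)
    eq = sym (+-suc d (suc p))
  ... | p′ , p<p′ , rest = p′ , ≤-trans (n≤1+n p) p<p′ , rest

  -- Low density up to n persists up to the next element of L after n, since L is empty in between.
  sparse-element : (∀ {m} → L m → 1 ≤ m) → Infinite L → LowerDensityZero L → ∀ q N →
    ∃[ ℓ ] (L ℓ × N ≤ ℓ × ∃[ ls ] (q * length ls ≤ ℓ × (∀ v → v < ℓ → L v → v ∈ ls)))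
  sparse-element pos inf ldz q N with ldz q N
  ... | n , N≤n , k , c , dens with inf (suc n)
  ... | m , n<m , Lm with ldz 0 m
  ... | n′ , m≤n′ , k′ , c′ , _
    with next-element (m ∸ suc n) c (subst L (sym (m∸n+n≡m n<m)) Lm)
           (λ v 1≤v v≤ → Count⇒dec c′ v 1≤v (≤-trans v≤ (≤-trans (≤-reflexive (m∸n+n≡m n<m)) m≤n′)))
  ... | p , n≤p , Lp , cp with Count⇒list cp
  ... | ls , refl , all =
    suc p , Lp , ≤-trans N≤n (≤-trans n≤p (n≤1+n p)) , ls ,
    ≤-trans (m≤n+m (q * length ls) (length ls)) (≤-trans (<⇒≤ dens) (≤-trans n≤p (n≤1+n p))) ,
    λ { v (s≤s v≤p) Lv → all v (pos Lv) v≤p Lv }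

-- Choice of the two edge lengths

-- Modulo a the factor 1 + a K is 1, so a divides α; cancelling a then gives β.
proportional : ∀ a K α β .{{_ : NonZero a}} → α * (1 + a * K) ≡ β * a →
  ∃[ m ] (α ≡ m * a × β ≡ m * (1 + a * K))
proportional a K α β eq with ∣m+n∣m⇒∣n (divides β (trans (lem a K α) eq)) (divides (α * K) refl)
  where
  lem : ∀ a K α → α * K * a + α ≡ α * (1 + a * K)
  lem = solve-∀
... | divides m refl = m , refl , sym (*-cancelʳ-≡ (m * (1 + a * K)) β a (trans (lem a K m) eq))
  where
  lem : ∀ a K m → m * (1 + a * K) * a ≡ m * a * (1 + a * K)
  lem = solve-∀

-- The points (`x z` , `y z`) with z ≤ Z are consecutive integral points of the line, each step
-- trading c from x for a to y. Z is the number of triples formed by a pair in the box and an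
-- element of `ls`, so the Z + 1 points outnumber the possible offences.
module Family (a K A B ℓ x₀ y₀ Z : ℕ) (ls : List ℕ) .{{_ : NonZero a}}
  (Z≡ : suc A * suc B * length ls ≡ Z)
  (total : a * x₀ + (1 + a * K) * y₀ + a * (1 + a * K) * Z ≡ ℓ) where

  c : ℕ
  c = 1 + a * K

  x y : ℕ → ℕ
  x z = x₀ + c * (Z ∸ z)
  y z = y₀ + a * z

  on-line : ∀ z → z ≤ Z → a * x z + c * y z ≡ ℓ
  on-line z z≤Z = begin
    a * (x₀ + c * (Z ∸ z)) + c * (y₀ + a * z)   ≡⟨ lem a c x₀ y₀ (Z ∸ z) z ⟩
    a * x₀ + c * y₀ + a * c * (z + (Z ∸ z))     ≡⟨ cong (λ u → a * x₀ + c * y₀ + a * c * u) (m+[n∸m]≡n z≤Z) ⟩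
    a * x₀ + c * y₀ + a * c * Z                 ≡⟨ total ⟩
    ℓ                                           ∎
    where
    open ≡-Reasoning
    lem : ∀ a c x₀ y₀ d z → a * (x₀ + c * d) + c * (y₀ + a * z) ≡ a * x₀ + c * y₀ + a * c * (z + d)
    lem = solve-∀

  len : ℕ → ℕ × ℕ → ℕ
  len z (α , β) = α * x z + β * y z

  Forbidden : ℕ → ℕ × ℕ → Set
  Forbidden z e = (len z e ∈ ls) × (0 < len z e) × (len z e < ℓ)

  -- Moving from z to z′ changes the length by (β a - α c)(z′ - z). The proof keeps to addition by
  -- writing z′ = z + d and Z = z + d + e.
  collision-proportional : ∀ {z z′} α β → z < z′ → z′ ≤ Z → len z (α , β) ≡ len z′ (α , β) → α * c ≡ β * a
  collision-proportional {z} {z′} α β z<z′ z′≤Z eq =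
    *-cancelʳ-≡ (α * c) (β * a) d {{>-nonZero (m<n⇒0<n∸m z<z′)}}
      (+-cancelʳ-≡ (α * (x₀ + c * e) + β * (y₀ + a * z)) _ _
        (trans (lem α β a c d e x₀ y₀ z)
          (trans (subst₃ eq) (lem′ α β a c d e x₀ y₀ z))))
    where
    d e : ℕ
    d = z′ ∸ z
    e = Z ∸ z′
    z+d : z + d ≡ z′
    z+d = m+[n∸m]≡n (<⇒≤ z<z′)
    Z∸z : Z ∸ z ≡ d + e
    Z∸z = trans (cong (_∸ z) (sym (trans (sym (+-assoc z d e)) (trans (cong (_+ e) z+d) (m+[n∸m]≡n z′≤Z)))))
            (m+n∸m≡n z (d + e))
    subst₃ : len z (α , β) ≡ len z′ (α , β) →
      α * (x₀ + c * (d + e)) + β * (y₀ + a * z) ≡ α * (x₀ + c * e) + β * (y₀ + a * (z + d))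
    subst₃ h = trans (cong (λ u → α * (x₀ + c * u) + β * (y₀ + a * z)) (sym Z∸z))
      (trans h (cong (λ u → α * (x₀ + c * e) + β * (y₀ + a * u)) (sym z+d)))
    lem : ∀ α β a c d e x₀ y₀ z → α * c * d + (α * (x₀ + c * e) + β * (y₀ + a * z))
      ≡ α * (x₀ + c * (d + e)) + β * (y₀ + a * z)
    lem = solve-∀
    lem′ : ∀ α β a c d e x₀ y₀ z → α * (x₀ + c * e) + β * (y₀ + a * (z + d))
      ≡ β * a * d + (α * (x₀ + c * e) + β * (y₀ + a * z))
    lem′ = solve-∀

  -- A collision makes (α , β) = m (a , c), so the length is m ℓ. The two bounds in `Forbidden`
  -- exclude this: m = 0 gives length 0, and m ≥ 1 gives at least ℓ.
  no-collision : ∀ {z z′} e → z < z′ → z′ ≤ Z → Forbidden z e → len z e ≡ len z′ e → ⊥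
  no-collision {z} {z′} (α , β) z<z′ z′≤Z (_ , pos , small) eq
    with proportional a K α β (collision-proportional α β z<z′ z′≤Z eq)
  ... | m , refl , refl = contra m refl
    where
    lem : ∀ m a c x y → m * (a * x + c * y) ≡ m * a * x + m * c * y
    lem = solve-∀
    mℓ : ∀ m′ → m′ * ℓ ≡ m′ * a * x z + m′ * c * y z
    mℓ m′ = trans (cong (m′ *_) (sym (on-line z (≤-trans (<⇒≤ z<z′) z′≤Z)))) (lem m′ a c (x z) (y z))
    contra : ∀ m′ → m′ ≡ m → ⊥
    contra zero refl = <-irrefl (mℓ 0) pos
    contra (suc m′) refl = <-irrefl refl (<-≤-trans small (≤-trans (m≤m+n ℓ (m′ * ℓ)) (≤-reflexive (mℓ (suc m′)))))

  Box : List (ℕ × ℕ)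
  Box = cartesianProduct (upTo (suc A)) (upTo (suc B))

  bad? : ∀ z → Dec (Any (Forbidden z) Box)
  bad? z = any? (λ e → (len z e ∈? ls) ×-dec (0 <? len z e) ×-dec (len z e <? ℓ)) Box

  -- If every z were bad, then z ↦ (offending coefficients, offending element of ls) would be an
  -- injection of a set of Z + 1 elements into one of Z elements.
  good-z : ∃[ z ] (z ≤ Z × ¬ Any (Forbidden z) Box)
  good-z with Finₚ.any? {n = suc Z} (λ i → ¬? (bad? (toℕ i)))
  ... | yes (i , h) = toℕ i , ℕ.s≤s⁻¹ (Finₚ.toℕ<n i) , h
  ... | no none = ⊥-elim (<-irrefl refl (begin-strict
    Z                                  <⟨ ≤-refl ⟩
    suc Z                              ≡⟨ sym (length-tabulate g) ⟩
    length (tabulate g)                ≤⟨ unique-⊆-length (Uniqueₚ.tabulate⁺ g-injective) g-range ⟩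
    length (cartesianProduct Box ls)   ≡⟨ length-cartesianProduct Box ls ⟩
    length Box * length ls             ≡⟨ cong (_* length ls) (length-cartesianProduct (upTo (suc A)) (upTo (suc B))) ⟩
    length (upTo (suc A)) * length (upTo (suc B)) * length ls
      ≡⟨ cong₂ (λ u v → u * v * length ls) (length-upTo (suc A)) (length-upTo (suc B)) ⟩
    suc A * suc B * length ls          ≡⟨ Z≡ ⟩
    Z                                  ∎))
    where
    open ≤-Reasoning
    bad : ∀ (i : Fin (suc Z)) → ∃[ e ] (e ∈ Box × Forbidden (toℕ i) e)
    bad i = find (decidable-stable (bad? (toℕ i)) (λ h → none (i , h)))
    g : Fin (suc Z) → (ℕ × ℕ) × ℕ
    g i = proj₁ (bad i) , len (toℕ i) (proj₁ (bad i))
    ≤Z : ∀ (i : Fin (suc Z)) → toℕ i ≤ Z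
    ≤Z i = ℕ.s≤s⁻¹ (Finₚ.toℕ<n i)
    g-injective : ∀ {i j} → g i ≡ g j → i ≡ j
    g-injective {i} {j} eq with ,-injective eq | <-cmp (toℕ i) (toℕ j)
    ... | e , l | tri≈ _ p _ = Finₚ.toℕ-injective p
    ... | e , l | tri< p _ _ = ⊥-elim (no-collision (proj₁ (bad i)) p (≤Z j) (proj₂ (proj₂ (bad i)))
          (trans l (cong (len (toℕ j)) (sym e))))
    ... | e , l | tri> _ _ p = ⊥-elim (no-collision (proj₁ (bad j)) p (≤Z i) (proj₂ (proj₂ (bad j)))
          (trans (sym l) (cong (len (toℕ i)) e)))
    g-range : ∀ {v} → v ∈ tabulate g → v ∈ cartesianProduct Box ls
    g-range v∈ with ∈-tabulate⁻ {f = g} v∈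
    ... | i , refl = ∈-cartesianProduct⁺ (proj₁ (proj₂ (bad i))) (proj₁ (proj₂ (proj₂ (bad i))))

  lengths : 2 ≤ x₀ → 2 ≤ y₀ → ∀ C → C * (y₀ + a * Z) ≤ x₀ →
    ∃[ x ] ∃[ y ] (2 ≤ x × 2 ≤ y × C * y ≤ x × a * x + c * y ≡ ℓ ×
      (∀ α β → α ≤ A → β ≤ B → 0 < α * x + β * y → α * x + β * y < ℓ → ¬ (α * x + β * y ∈ ls)))
  lengths 2≤x₀ 2≤y₀ C big with good-z
  ... | z , z≤Z , good =
    x z , y z , ≤-trans 2≤x₀ (m≤m+n x₀ _) , ≤-trans 2≤y₀ (m≤m+n y₀ _) ,
    ≤-trans (*-monoʳ-≤ C (+-monoʳ-≤ y₀ (*-monoʳ-≤ a z≤Z))) (≤-trans big (m≤m+n x₀ _)) , on-line z z≤Z ,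
    λ α β α≤ β≤ pos small mem →
      good (lose (∈-cartesianProduct⁺ (∈-upTo⁺ (s≤s α≤)) (∈-upTo⁺ (s≤s β≤))) (mem , pos , small))

-- What has to fit below ℓ is a constant plus a multiple of the size of `ls`. The threshold N pays
-- for the first with one half of ℓ and the factor q for the second with the other half, hence the
-- two factors 2. The 5 is 2 + 2 from `large`, plus 1 for rounding in ℓ / a.
choose-lengths : ∀ a K C A B .{{_ : NonZero a}} → ∃[ q ] ∃[ N ] (∀ ℓ ls → N ≤ ℓ → q * length ls ≤ ℓ →
  ∃[ x ] ∃[ y ] (2 ≤ x × 2 ≤ y × C * y ≤ x × a * x + (1 + a * K) * y ≡ ℓ ×
    (∀ α β → α ≤ A → β ≤ B → 0 < α * x + β * y → α * x + β * y < ℓ → ¬ (α * x + β * y ∈ ls))))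
choose-lengths a K C A B = 2 * (a * ((c + C * a) * D)) , 2 * (a * (5 + (K + C) * (3 * a))) , result
  where
  c = 1 + a * K
  D = suc A * suc B
  module _ (ℓ : ℕ) (ls : List ℕ) (N≤ : 2 * (a * (5 + (K + C) * (3 * a))) ≤ ℓ)
           (q≤ : 2 * (a * ((c + C * a) * D)) * length ls ≤ ℓ) where
    k = length ls
    Z = D * k
    r = ℓ % a
    Q = ℓ / a
    -- As c ≡ 1 mod a, any solution has y ≡ ℓ mod a. Adding 2 a makes y at least 2 even when r = 0
    -- and a = 1.
    y₀ = r + 2 * a
    -- This is the part of Q used up by the y₀ and Z terms: c y₀ + a c Z = r + a `base`. The rest
    -- becomes x₀.
    base = 2 + K * y₀ + c * Z
    y₀≤ : y₀ ≤ 3 * a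
    y₀≤ = +-monoˡ-≤ (2 * a) (<⇒≤ (m%n<n ℓ a))
    large : base + (2 + C * (y₀ + a * Z)) ≤ Q
    large = ℕ.s≤s⁻¹ (*-cancelˡ-< a _ _ (begin-strict
      a * (base + (2 + C * (y₀ + a * Z)))
        ≡⟨ cong (a *_) (lem K C y₀ a c D k) ⟩
      a * (4 + (K + C) * y₀ + (c + C * a) * D * k)
        ≤⟨ *-monoʳ-≤ a (+-monoˡ-≤ ((c + C * a) * D * k) (+-monoʳ-≤ 4 (*-monoʳ-≤ (K + C) y₀≤))) ⟩
      a * (4 + (K + C) * (3 * a) + (c + C * a) * D * k)
        <⟨ *-monoʳ-< a ≤-refl ⟩
      a * (5 + (K + C) * (3 * a) + (c + C * a) * D * k)
        ≤⟨ *-cancelˡ-≤ 2 (begin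
          2 * (a * (5 + (K + C) * (3 * a) + (c + C * a) * D * k))   ≡⟨ lem′ a ((K + C) * (3 * a)) ((c + C * a) * D) k ⟩
          2 * (a * (5 + (K + C) * (3 * a))) + 2 * (a * ((c + C * a) * D)) * k   ≤⟨ +-mono-≤ N≤ q≤ ⟩
          ℓ + ℓ                                                    ≡⟨ cong (ℓ +_) (sym (+-identityʳ ℓ)) ⟩
          2 * ℓ ∎) ⟩
      ℓ               ≡⟨ m≡m%n+[m/n]*n ℓ a ⟩
      r + Q * a       <⟨ +-monoˡ-< (Q * a) (m%n<n ℓ a) ⟩
      a + Q * a       ≡⟨ *-comm (suc Q) a ⟩
      a * suc Q       ∎))
      where
      open ≤-Reasoning
      lem : ∀ K C y₀ a c D k → 2 + K * y₀ + c * (D * k) + (2 + C * (y₀ + a * (D * k)))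
        ≡ 4 + (K + C) * y₀ + (c + C * a) * D * k
      lem = solve-∀
      lem′ : ∀ a u v k → 2 * (a * (5 + u + v * k)) ≡ 2 * (a * (5 + u)) + 2 * (a * v) * k
      lem′ = solve-∀
    x₀ = Q ∸ base
    total : a * x₀ + c * y₀ + a * c * Z ≡ ℓ
    total = begin
      a * x₀ + c * y₀ + a * c * Z   ≡⟨ lem a K x₀ r Z ⟩
      r + (base + x₀) * a           ≡⟨ cong (λ u → r + u * a) (m+[n∸m]≡n (≤-trans (m≤m+n base _) large)) ⟩
      r + Q * a                     ≡⟨ sym (m≡m%n+[m/n]*n ℓ a) ⟩
      ℓ                             ∎
      where
      open ≡-Reasoning
      lem : ∀ a K x₀ r Z → a * x₀ + (1 + a * K) * (r + 2 * a) + a * (1 + a * K) * Z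
        ≡ r + (2 + K * (r + 2 * a) + (1 + a * K) * Z + x₀) * a
      lem = solve-∀
    x₀-large : 2 + C * (y₀ + a * Z) ≤ x₀
    x₀-large = m+n≤o⇒m≤o∸n _ (≤-trans (≤-reflexive (+-comm _ base)) large)
    result = Family.lengths a K A B ℓ x₀ y₀ Z ls refl total (m+n≤o⇒m≤o 2 x₀-large)
      (≤-trans (*-monoʳ-≤ 2 (>-nonZero⁻¹ a)) (m≤n+m (2 * a) r)) C (≤-trans (m≤n+m _ 2) x₀-large)

-- Closed walks and subdivided graphs

-- Same shape as the condition in `Cycle.adj`, so that its proofs can be handed to that field
-- directly.
CyclicSucc : ∀ {m} → Fin m → Fin m → Set
CyclicSucc {m} i j = (suc (toℕ i) ≡ toℕ j) ⊎ (suc (toℕ i) ≡ m × toℕ j ≡ 0)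

cyclic-succ : ∀ {m} (i : Fin m) → ∃[ j ] CyclicSucc i j
cyclic-succ {suc m} i with suc (toℕ i) <? suc m
... | yes p = fromℕ< p , inj₁ (sym (Finₚ.toℕ-fromℕ< p))
... | no ¬p = zero , inj₂ (≤-antisym (Finₚ.toℕ<n i) (≮⇒≥ ¬p) , refl)

cyclic-pred : ∀ {m} (j : Fin m) → ∃[ i ] CyclicSucc i j
cyclic-pred {suc m} zero = fromℕ m , inj₂ (cong suc (Finₚ.toℕ-fromℕ m) , refl)
cyclic-pred {suc m} (suc j) = inject₁ j , inj₁ (cong suc (Finₚ.toℕ-inject₁ j))

CyclicSucc-functional : ∀ {m} {i j k : Fin m} → CyclicSucc i j → CyclicSucc i k → j ≡ k
CyclicSucc-functional (inj₁ p) (inj₁ q) = Finₚ.toℕ-injective (trans (sym p) q)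
CyclicSucc-functional {j = j} (inj₁ p) (inj₂ (q , _)) = ⊥-elim (<-irrefl (trans (sym p) q) (Finₚ.toℕ<n j))
CyclicSucc-functional {k = k} (inj₂ (p , _)) (inj₁ q) = ⊥-elim (<-irrefl (trans (sym q) p) (Finₚ.toℕ<n k))
CyclicSucc-functional (inj₂ (_ , p)) (inj₂ (_ , q)) = Finₚ.toℕ-injective (trans p (sym q))

-- Length at least 3 forbids a step followed by its own reversal. This keeps a cycle from using a
-- slot twice, and a closed walk with distinct starts from using an edge twice.
CyclicSucc-no-2-cycle : ∀ {m} {i j : Fin m} → 3 ≤ m → CyclicSucc i j → CyclicSucc j i → ⊥
CyclicSucc-no-2-cycle {i = i} m≥3 (inj₁ p) (inj₁ q) = m≢1+m+n (toℕ i) (trans (sym q) (cong suc (trans (sym p) (+-comm 1 (toℕ i)))))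
CyclicSucc-no-2-cycle m≥3 (inj₁ p) (inj₂ (q , r)) =
  <-irrefl refl (≤-trans m≥3 (≤-reflexive (trans (sym q) (cong suc (trans (sym p) (cong suc r))))))
CyclicSucc-no-2-cycle m≥3 (inj₂ (p , r)) (inj₁ q) =
  <-irrefl refl (≤-trans m≥3 (≤-reflexive (trans (sym p) (cong suc (trans (sym q) (cong suc r))))))
CyclicSucc-no-2-cycle m≥3 (inj₂ (p , r)) (inj₂ (q , r′)) =
  <-irrefl refl (≤-trans (≤-trans (n≤1+n 2) m≥3) (≤-reflexive (trans (sym p) (cong suc r′))))

does⇒ : ∀ {P : Set} (d : Dec P) → does d ≡ true → P
does⇒ (yes p) _ = p

lookup-injective : ∀ {A B : Set} (f : A → B) {xs : List A} → AllPairs (λ x y → f x ≢ f y) xs →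
  ∀ i j → f (lookup xs i) ≡ f (lookup xs j) → i ≡ j
lookup-injective f {x ∷ xs} _ zero zero _ = refl
lookup-injective f {x ∷ xs} (x∉ ∷ _) zero (suc j) eq = ⊥-elim (All.lookup x∉ (∈-lookup j) eq)
lookup-injective f {x ∷ xs} (x∉ ∷ _) (suc i) zero eq = ⊥-elim (All.lookup x∉ (∈-lookup i) (sym eq))
lookup-injective f {x ∷ xs} (_ ∷ u) (suc i) (suc j) eq = cong suc (lookup-injective f u i j eq)

lookup-injective⁻ : ∀ {A B : Set} (f : A → B) {xs : List A} →
  (∀ i j → f (lookup xs i) ≡ f (lookup xs j) → i ≡ j) → AllPairs (λ x y → f x ≢ f y) xs
lookup-injective⁻ f {[]} _ = []
lookup-injective⁻ f {x ∷ xs} inj =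
  All.tabulate (λ y∈ eq → case inj zero (suc (Any.index y∈)) (trans eq (cong f (lookup-index y∈))) of λ ())
  ∷ lookup-injective⁻ f (λ i j eq → Finₚ.suc-injective (inj (suc i) (suc j) eq))

-- The darts are abstract because three kinds occur: steps between consecutive points of the
-- subdivision, whole edges between drawn points, and whole edges between grid coordinates.
module Walks {A V : Set} (start end : A → V) where

  data Walk : V → List A → V → Set where
    [] : ∀ {u} → Walk u [] u
    step : ∀ {u ds v} d → start d ≡ u → Walk (end d) ds v → Walk u (d ∷ ds) v

  infixr 5 _++ʷ_
  _++ʷ_ : ∀ {u v z xs ys} → Walk u xs v → Walk v ys z → Walk u (xs ++ ys) z
  [] ++ʷ q = q
  step d eq p ++ʷ q = step d eq (p ++ʷ q)

  walk-first : ∀ {u ds v} → Walk u ds v → ∀ i → toℕ i ≡ 0 → start (lookup ds i) ≡ u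
  walk-first (step d eq p) zero _ = eq

  walk-last : ∀ {u ds v} → Walk u ds v → ∀ i → suc (toℕ i) ≡ length ds → end (lookup ds i) ≡ v
  walk-last (step d eq []) zero _ = refl
  walk-last (step d eq (step _ _ _)) zero ()
  walk-last (step d eq p) (suc i) h = walk-last p i (suc-injective h)

  walk-consecutive : ∀ {u ds v} → Walk u ds v → ∀ i j → suc (toℕ i) ≡ toℕ j → end (lookup ds i) ≡ start (lookup ds j)
  walk-consecutive (step d eq p) zero (suc j) h = sym (walk-first p j (suc-injective (sym h)))
  walk-consecutive (step d eq p) (suc i) (suc j) h = walk-consecutive p i j (suc-injective h)

  closed-walk : ∀ {u ds} → Walk u ds u → ∀ {i j} → CyclicSucc i j → end (lookup ds i) ≡ start (lookup ds j)
  closed-walk p {i} {j} (inj₁ h) = walk-consecutive p i j h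
  closed-walk p {i} {j} (inj₂ (h , h′)) = trans (walk-last p i h) (sym (walk-first p j h′))

-- An edge e is given by its points `vtx e 0`, ..., `vtx e (w e)`, and edges share a vertex when
-- their points coincide. The hypothesis `interior` allows this at ends only. A slot (e , k) is the
-- k-th piece of e.
module Subdivision
  {V E : Set} (_≟V_ : DecidableEquality V) (_≟E_ : DecidableEquality E)
  (es : List E) (es! : Unique es) (w : E → ℕ) (vtx : E → ℕ → V)
  (vtx-injective : ∀ e j k → vtx e j ≡ vtx e k → j ≡ k)
  (interior : ∀ e e′ k k′ → e ∈ es → e′ ∈ es → 0 < k → k < w e → k′ ≤ w e′ →
    vtx e k ≡ vtx e′ k′ → e ≡ e′) where

  Slot : Set
  Slot = E × ℕ

  IsSlot : Slot → Set
  IsSlot (e , k) = e ∈ es × k < w e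

  lft rgt : Slot → V
  lft (e , k) = vtx e k
  rgt (e , k) = vtx e (suc k)

  Joins : Slot → V → V → Set
  Joins s u v = (u ≡ lft s × v ≡ rgt s) ⊎ (u ≡ rgt s × v ≡ lft s)

  slotsOf : List E → List Slot
  slotsOf = concatMap (λ e → map (e ,_) (upTo (w e)))

  ∈-slotsOf⁺ : ∀ {es′ e k} → e ∈ es′ → k < w e → (e , k) ∈ slotsOf es′
  ∈-slotsOf⁺ e∈ k< = ∈-concatMap⁺ (λ e → map (e ,_) (upTo (w e))) (lose e∈ (∈-map⁺ _ (∈-upTo⁺ k<)))

  ∈-slotsOf⁻ : ∀ {es′ e k} → (e , k) ∈ slotsOf es′ → e ∈ es′ × k < w e
  ∈-slotsOf⁻ {es′} s∈ with find (∈-concatMap⁻ (λ e → map (e ,_) (upTo (w e))) {xs = es′} s∈)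
  ... | e′ , e′∈ , s∈′ with ∈-map⁻ (e′ ,_) s∈′
  ... | k , k∈ , refl = e′∈ , ∈-upTo⁻ k∈

  slotsOf-unique : ∀ {es′} → Unique es′ → Unique (slotsOf es′)
  slotsOf-unique [] = []
  slotsOf-unique {e ∷ es′} (e∉ ∷ u) =
    Uniqueₚ.++⁺ (Uniqueₚ.map⁺ ,-injectiveʳ (Uniqueₚ.upTo⁺ (w e))) (slotsOf-unique u)
      (λ { (p , q) → case ∈-map⁻ (e ,_) p of λ where
        (k , _ , refl) → All.lookup e∉ (proj₁ (∈-slotsOf⁻ {es′} q)) refl })

  length-slotsOf : ∀ es′ → length (slotsOf es′) ≡ sum (map w es′)
  length-slotsOf [] = refl
  length-slotsOf (e ∷ es′) = trans (length-++ (map (e ,_) (upTo (w e))))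
    (cong₂ _+_ (trans (length-map (e ,_) (upTo (w e))) (length-upTo (w e))) (length-slotsOf es′))

  vs₀ vs : List V
  vs₀ = concatMap (λ e → map (vtx e) (upTo (suc (w e)))) es
  vs = deduplicate _≟V_ vs₀

  pt : Fin (length vs) → V
  pt = lookup vs

  pt-injective : ∀ {i j} → pt i ≡ pt j → i ≡ j
  pt-injective = lookup-injective (λ v → v) (deduplicate-! _≟V_ vs₀) _ _

  index-of : ∀ e k → e ∈ es → k ≤ w e → ∃[ i ] pt i ≡ vtx e k
  index-of e k e∈ k≤ = Any.index v∈ , sym (lookup-index v∈)
    where
    v∈ : vtx e k ∈ vs
    v∈ = ∈-deduplicate⁺ _≟V_ (∈-concatMap⁺ (λ e → map (vtx e) (upTo (suc (w e))))
           (lose e∈ (∈-map⁺ (vtx e) (∈-upTo⁺ (s≤s k≤)))))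

  Linked : V → V → Set
  Linked u v = Any (λ s → Joins s u v) (slotsOf es)

  linked? : ∀ u v → Dec (Linked u v)
  linked? u v = any? (λ s → ((u ≟V lft s) ×-dec (v ≟V rgt s)) ⊎-dec ((u ≟V rgt s) ×-dec (v ≟V lft s))) (slotsOf es)

  Joins-sym : ∀ {s u v} → Joins s u v → Joins s v u
  Joins-sym (inj₁ (p , q)) = inj₂ (q , p)
  Joins-sym (inj₂ (p , q)) = inj₁ (q , p)

  lft≢rgt : ∀ s → lft s ≢ rgt s
  lft≢rgt (e , k) eq = m≢1+m+n k (trans (vtx-injective e _ _ eq) (sym (cong suc (+-identityʳ k))))

  Joins⇒≢ : ∀ {s u v} → Joins s u v → u ≢ v
  Joins⇒≢ {s} (inj₁ (p , q)) eq = lft≢rgt s (trans (sym p) (trans eq q))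
  Joins⇒≢ {s} (inj₂ (p , q)) eq = lft≢rgt s (trans (sym q) (trans (sym eq) p))

  graph : Graph
  graph = record
    { n = length vs
    ; Adj = λ i j → does (linked? (pt i) (pt j))
    ; sym = λ i j → sym-does (linked? (pt i) (pt j)) (linked? (pt j) (pt i))
    ; irrefl = λ i → dec-false (linked? (pt i) (pt i)) (λ l → Joins⇒≢ (proj₂ (proj₂ (find l))) refl)
    }
    where
    sym-does : ∀ {u v} (d : Dec (Linked u v)) (d′ : Dec (Linked v u)) → does d ≡ does d′
    sym-does (yes _) (yes _) = refl
    sym-does (no _) (no _) = refl
    sym-does (yes p) (no ¬q) = ⊥-elim (¬q (Any.map Joins-sym p))
    sym-does (no ¬p) (yes q) = ⊥-elim (¬p (Any.map Joins-sym q))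

  adjacent⇒slot : ∀ i j → Graph.Adj graph i j ≡ true → ∃[ s ] (IsSlot s × Joins s (pt i) (pt j))
  adjacent⇒slot i j adj with find (does⇒ (linked? (pt i) (pt j)) adj)
  ... | s , s∈ , js = s , ∈-slotsOf⁻ {es} s∈ , js

  slot⇒adjacent : ∀ s i j → IsSlot s → Joins s (pt i) (pt j) → Graph.Adj graph i j ≡ true
  slot⇒adjacent s i j (e∈ , k<) js = dec-true (linked? (pt i) (pt j)) (lose (∈-slotsOf⁺ e∈ k<) js)

  -- Subdivision points have degree two, which is what forces a cycle through one of them to
  -- continue along the same edge.
  interior-slot : ∀ e k e′ k′ → e ∈ es → suc k < w e → IsSlot (e′ , k′) →
    (vtx e (suc k) ≡ vtx e′ k′) ⊎ (vtx e (suc k) ≡ vtx e′ (suc k′)) →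
    (e′ , k′) ≡ (e , k) ⊎ (e′ , k′) ≡ (e , suc k)
  interior-slot e k e′ k′ e∈ k< (e′∈ , k′<) (inj₁ eq) with interior e e′ (suc k) k′ e∈ e′∈ (s≤s z≤n) k< (<⇒≤ k′<) eq
  ... | refl = inj₂ (cong (e ,_) (vtx-injective e _ _ (sym eq)))
  interior-slot e k e′ k′ e∈ k< (e′∈ , k′<) (inj₂ eq) with interior e e′ (suc k) (suc k′) e∈ e′∈ (s≤s z≤n) k< k′< eq
  ... | refl = inj₁ (cong (e ,_) (suc-injective (vtx-injective e _ _ (sym eq))))

  -- A cycle contains each edge entirely or not at all, so its length is a sum of edge weights. `σ`
  -- sends a step to the slot it traverses, and slot 0 serves as the test for whether an edge is
  -- used.
  module CycleEdges (C : Cycle graph) where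
    open Cycle C

    vertex : Fin len → V
    vertex i = pt (vert i)

    vertex-injective : ∀ {i j} → vertex i ≡ vertex j → i ≡ j
    vertex-injective eq = inj _ _ (pt-injective eq)

    next : Fin len → Fin len
    next i = proj₁ (cyclic-succ i)

    step : ∀ i → ∃[ s ] (IsSlot s × Joins s (vertex i) (vertex (next i)))
    step i = adjacent⇒slot (vert i) (vert (next i)) (adj i (next i) (proj₂ (cyclic-succ i)))

    σ : Fin len → Slot
    σ i = proj₁ (step i)

    σ-joins : ∀ i → Joins (σ i) (vertex i) (vertex (next i))
    σ-joins i = proj₂ (proj₂ (step i))

    no-swap : ∀ i j → i ≡ next j → j ≡ next i → ⊥
    no-swap i j p q = CyclicSucc-no-2-cycle len≥3
      (subst (CyclicSucc i) (sym q) (proj₂ (cyclic-succ i)))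
      (subst (CyclicSucc j) (sym p) (proj₂ (cyclic-succ j)))

    -- Two steps over one slot either agree in direction, hence start at the same vertex, or are
    -- opposite, hence each is followed by the other.
    σ-injective : ∀ {i j} → σ i ≡ σ j → i ≡ j
    σ-injective {i} {j} eq with subst (λ s → Joins s (vertex i) (vertex (next i))) eq (σ-joins i) | σ-joins j
    ... | inj₁ (p , _) | inj₁ (q , _) = vertex-injective (trans p (sym q))
    ... | inj₂ (p , _) | inj₂ (q , _) = vertex-injective (trans p (sym q))
    ... | inj₁ (p , p′) | inj₂ (q , q′) =
          ⊥-elim (no-swap i j (vertex-injective (trans p (sym q′))) (vertex-injective (trans q (sym p′))))
    ... | inj₂ (p , p′) | inj₁ (q , q′) =
          ⊥-elim (no-swap i j (vertex-injective (trans p (sym q′))) (vertex-injective (trans q (sym p′))))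

    Used : Slot → Set
    Used s = ∃[ i ] σ i ≡ s

    used? : ∀ s → Dec (Used s)
    used? s = Finₚ.any? (λ i → ≡-dec _≟E_ ℕ._≟_ (σ i) s)

    joins-first : ∀ {e k u v} → Joins (e , k) u v → (u ≡ vtx e k) ⊎ (u ≡ vtx e (suc k))
    joins-first (inj₁ (p , _)) = inj₁ p
    joins-first (inj₂ (p , _)) = inj₂ p

    -- The two steps of the cycle at an interior point of e are distinct, hence they use both slots of e at that point.
    both-used : ∀ e k p → e ∈ es → suc k < w e → vertex p ≡ vtx e (suc k) → Used (e , k) × Used (e , suc k)
    both-used e k p e∈ k< eq with cyclic-pred p
    ... | i , i→p = resolve
            (interior-slot e k _ _ e∈ k< (proj₁ (proj₂ (step i)))
              (case joins-first (Joins-sym (subst (λ j → Joins (σ i) (vertex i) (vertex j)) next-i (σ-joins i))) of λ where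
                (inj₁ h) → inj₁ (trans (sym eq) h)
                (inj₂ h) → inj₂ (trans (sym eq) h)))
            (interior-slot e k _ _ e∈ k< (proj₁ (proj₂ (step p)))
              (case joins-first (σ-joins p) of λ where
                (inj₁ h) → inj₁ (trans (sym eq) h)
                (inj₂ h) → inj₂ (trans (sym eq) h)))
      where
      next-i : next i ≡ p
      next-i = CyclicSucc-functional (proj₂ (cyclic-succ i)) i→p
      i≢p : i ≢ p
      i≢p i≡p = Joins⇒≢ (σ-joins i) (cong vertex (trans i≡p (sym next-i)))
      resolve : σ i ≡ (e , k) ⊎ σ i ≡ (e , suc k) → σ p ≡ (e , k) ⊎ σ p ≡ (e , suc k) → Used (e , k) × Used (e , suc k)
      resolve (inj₁ a) (inj₂ b) = (i , a) , (p , b)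
      resolve (inj₂ a) (inj₁ b) = (p , b) , (i , a)
      resolve (inj₁ a) (inj₁ b) = ⊥-elim (i≢p (σ-injective (trans a (sym b))))
      resolve (inj₂ a) (inj₂ b) = ⊥-elim (i≢p (σ-injective (trans a (sym b))))

    on-cycle : ∀ {s} → Used s → (∃[ p ] vertex p ≡ lft s) × (∃[ p ] vertex p ≡ rgt s)
    on-cycle (i , refl) with σ-joins i
    ... | inj₁ (p , q) = (i , p) , (next i , q)
    ... | inj₂ (p , q) = (next i , q) , (i , p)

    used-suc : ∀ e k → e ∈ es → suc k < w e → Used (e , k) → Used (e , suc k)
    used-suc e k e∈ k< u = let (p , eq) = proj₂ (on-cycle u) in proj₂ (both-used e k p e∈ k< eq)

    used-pred : ∀ e k → e ∈ es → suc k < w e → Used (e , suc k) → Used (e , k)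
    used-pred e k e∈ k< u = let (p , eq) = proj₁ (on-cycle u) in proj₁ (both-used e k p e∈ k< eq)

    used-all : ∀ e k → e ∈ es → k < w e → Used (e , 0) → Used (e , k)
    used-all e zero e∈ k< u = u
    used-all e (suc k) e∈ k< u = used-suc e k e∈ k< (used-all e k e∈ (<⇒≤ k<) u)

    used-zero : ∀ e k → e ∈ es → k < w e → Used (e , k) → Used (e , 0)
    used-zero e zero e∈ k< u = u
    used-zero e (suc k) e∈ k< u = used-zero e k e∈ (<⇒≤ k<) (used-pred e k e∈ k< u)

    usedEdges : List E
    usedEdges = filter (λ e → used? (e , 0)) es

    -- Two duplicate-free lists with the same members are compared: the slots traversed by the
    -- steps, and all slots of the used edges.
    length-as-sum : len ≡ sum (map w usedEdges)
    length-as-sum = begin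
      len                          ≡⟨ sym (trans (length-map σ (allFin len)) (length-allFin len)) ⟩
      length (map σ (allFin len))  ≡⟨ ≤-antisym (unique-⊆-length σ! to) (unique-⊆-length (slotsOf-unique (Uniqueₚ.filter⁺ _ es!)) from) ⟩
      length (slotsOf usedEdges)   ≡⟨ length-slotsOf usedEdges ⟩
      sum (map w usedEdges)        ∎
      where
      open ≡-Reasoning
      σ! : Unique (map σ (allFin len))
      σ! = Uniqueₚ.map⁺ σ-injective (Uniqueₚ.allFin⁺ len)
      to : ∀ {s} → s ∈ map σ (allFin len) → s ∈ slotsOf usedEdges
      to s∈ with ∈-map⁻ σ s∈
      ... | i , _ , refl = ∈-slotsOf⁺ (∈-filter⁺ (λ e → used? (e , 0)) e∈ (used-zero _ _ e∈ k< (i , refl))) k<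
        where
        e∈ = proj₁ (proj₁ (proj₂ (step i)))
        k< = proj₂ (proj₁ (proj₂ (step i)))
      from : ∀ {s} → s ∈ slotsOf usedEdges → s ∈ map σ (allFin len)
      from {e , k} s∈ with ∈-slotsOf⁻ {usedEdges} s∈
      ... | e∈U , k< with ∈-filter⁻ (λ e → used? (e , 0)) {xs = es} e∈U
      ... | e∈ , u with used-all e k e∈ k< u
      ... | i , refl = ∈-map⁺ σ (∈-allFin i)

  -- Cycles from closed walks along whole edges

  Dart GraphStep : Set
  Dart = E × Bool
  GraphStep = Slot × Bool

  edge : Dart → E
  edge = proj₁

  dstart dend : Dart → V
  dstart (e , true) = vtx e 0
  dstart (e , false) = vtx e (w e)
  dend (e , b) = dstart (e , not b)

  gstart gend : GraphStep → V
  gstart (s , true) = lft s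
  gstart (s , false) = rgt s
  gend (s , b) = gstart (s , not b)

  open Walks dstart dend
  module G = Walks gstart gend

  forward : E → ℕ → ℕ → List GraphStep
  forward e k zero = []
  forward e k (suc n) = ((e , k) , true) ∷ forward e (suc k) n

  backward : E → ℕ → List GraphStep
  backward e zero = []
  backward e (suc n) = ((e , n) , false) ∷ backward e n

  expand : Dart → List GraphStep
  expand (e , true) = forward e 0 (w e)
  expand (e , false) = backward e (w e)

  length-forward : ∀ e k n → length (forward e k n) ≡ n
  length-forward e k zero = refl
  length-forward e k (suc n) = cong suc (length-forward e (suc k) n)

  length-backward : ∀ e n → length (backward e n) ≡ n
  length-backward e zero = refl
  length-backward e (suc n) = cong suc (length-backward e n)

  length-expand : ∀ ds → length (concatMap expand ds) ≡ sum (map (w ∘ edge) ds)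
  length-expand [] = refl
  length-expand (d ∷ ds) = trans (length-++ (expand d)) (cong₂ _+_ (length-one d) (length-expand ds))
    where
    length-one : ∀ d → length (expand d) ≡ w (edge d)
    length-one (e , true) = length-forward e 0 (w e)
    length-one (e , false) = length-backward e (w e)

  forward-walk : ∀ e k n → G.Walk (vtx e k) (forward e k n) (vtx e (k + n))
  forward-walk e k zero = subst (G.Walk (vtx e k) []) (cong (vtx e) (sym (+-identityʳ k))) G.[]
  forward-walk e k (suc n) = G.step _ refl
    (subst (G.Walk (vtx e (suc k)) (forward e (suc k) n)) (cong (vtx e) (sym (+-suc k n))) (forward-walk e (suc k) n))

  backward-walk : ∀ e n → G.Walk (vtx e n) (backward e n) (vtx e 0)
  backward-walk e zero = G.[]
  backward-walk e (suc n) = G.step _ refl (backward-walk e n)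

  expand-walk : ∀ {u ds v} → Walk u ds v → G.Walk u (concatMap expand ds) v
  expand-walk [] = G.[]
  expand-walk (step (e , true) refl p) = forward-walk e 0 (w e) G.++ʷ expand-walk p
  expand-walk (step (e , false) refl p) = backward-walk e (w e) G.++ʷ expand-walk p

  ∈-forward : ∀ {x e} k n → x ∈ forward e k n → ∃[ i ] (k ≤ i × i < k + n × x ≡ ((e , i) , true))
  ∈-forward k (suc n) (here refl) = k , ≤-refl , m<m+n k (s≤s z≤n) , refl
  ∈-forward k (suc n) (there x∈) with ∈-forward (suc k) n x∈
  ... | i , k<i , i< , eq = i , <⇒≤ k<i , subst (i <_) (sym (+-suc k n)) i< , eq

  ∈-backward : ∀ {x e} n → x ∈ backward e n → ∃[ i ] (i < n × x ≡ ((e , i) , false))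
  ∈-backward (suc n) (here refl) = n , ≤-refl , refl
  ∈-backward (suc n) (there x∈) with ∈-backward n x∈
  ... | i , i< , eq = i , m≤n⇒m≤1+n i< , eq

  ∈-expand-slot : ∀ {x} d → x ∈ expand d → ∃[ k ] (k < w (edge d) × proj₁ x ≡ (edge d , k))
  ∈-expand-slot (e , true) x∈ with ∈-forward 0 (w e) x∈
  ... | i , _ , i< , refl = i , i< , refl
  ∈-expand-slot (e , false) x∈ with ∈-backward (w e) x∈
  ... | i , i< , refl = i , i< , refl

  ∈-expand : ∀ {x} d → x ∈ expand d →
    gstart x ≡ dstart d ⊎ ∃[ k ] (0 < k × k < w (edge d) × gstart x ≡ vtx (edge d) k)
  ∈-expand (e , true) x∈ with ∈-forward 0 (w e) x∈
  ... | zero , _ , _ , refl = inj₁ refl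
  ... | suc i , _ , i< , refl = inj₂ (suc i , s≤s z≤n , i< , refl)
  ∈-expand (e , false) x∈ with ∈-backward (w e) x∈
  ... | i , i< , refl with m≤n⇒m<n∨m≡n i<
  ... | inj₁ h = inj₂ (suc i , s≤s z≤n , h , refl)
  ... | inj₂ h = inj₁ (cong (vtx e) h)

  -- Starts suffice, because the end of each step is the start of the next: a closed walk visits
  -- every vertex as a start.
  StartsDiffer : GraphStep → GraphStep → Set
  StartsDiffer x y = gstart x ≢ gstart y

  expand-unique : ∀ d → AllPairs StartsDiffer (expand d)
  expand-unique (e , true) = go 0 (w e)
    where
    go : ∀ k n → AllPairs StartsDiffer (forward e k n)
    go k zero = []
    go k (suc n) = All.tabulate (λ y∈ eq → case ∈-forward (suc k) n y∈ of λ where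
      (i , k<i , _ , refl) → <-irrefl (vtx-injective e k i eq) k<i) ∷ go (suc k) n
  expand-unique (e , false) = go (w e)
    where
    go : ∀ n → AllPairs StartsDiffer (backward e n)
    go zero = []
    go (suc n) = All.tabulate (λ y∈ eq → case ∈-backward n y∈ of λ where
      (i , i<n , refl) → <-irrefl (suc-injective (vtx-injective e _ _ (sym eq))) i<n) ∷ go n

  dart-point : ∀ d → ∃[ k ] (k ≤ w (edge d) × dstart d ≡ vtx (edge d) k)
  dart-point (e , true) = 0 , z≤n , refl
  dart-point (e , false) = w e , ≤-refl , refl

  expand-disjoint : ∀ d d′ {x x′} → edge d ∈ es → edge d′ ∈ es → dstart d ≢ dstart d′ → edge d ≢ edge d′ →
    x ∈ expand d → x′ ∈ expand d′ → StartsDiffer x x′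
  expand-disjoint d d′ e∈ e′∈ ≢start ≢edge x∈ x′∈ eq with ∈-expand d x∈ | ∈-expand d′ x′∈
  ... | inj₁ p | inj₁ q = ≢start (trans (sym p) (trans eq q))
  ... | inj₂ (k , 0<k , k< , p) | inj₂ (k′ , _ , k′< , q) =
        ≢edge (interior _ _ k k′ e∈ e′∈ 0<k k< (<⇒≤ k′<) (trans (sym p) (trans eq q)))
  ... | inj₂ (k , 0<k , k< , p) | inj₁ q = let (k′ , k′≤ , r) = dart-point d′ in
        ≢edge (interior _ _ k k′ e∈ e′∈ 0<k k< k′≤ (trans (sym p) (trans eq (trans q r))))
  ... | inj₁ p | inj₂ (k , 0<k , k< , q) = let (k′ , k′≤ , r) = dart-point d in
        ≢edge (sym (interior _ _ k k′ e′∈ e∈ 0<k k< k′≤ (trans (sym q) (trans (sym eq) (trans p r)))))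

  expand-all-unique : ∀ {ds} → All (λ d → edge d ∈ es) ds →
    AllPairs (λ d d′ → dstart d ≢ dstart d′) ds → AllPairs (λ d d′ → edge d ≢ edge d′) ds →
    AllPairs StartsDiffer (concatMap expand ds)
  expand-all-unique [] [] [] = []
  expand-all-unique {d ∷ ds} (e∈ ∷ es∈) (s ∷ ss) (t ∷ ts) =
    AllPairsₚ.++⁺ (expand-unique d) (expand-all-unique es∈ ss ts)
      (All.tabulate (λ x∈ → All.tabulate (λ y∈ → case find (∈-concatMap⁻ expand {xs = ds} y∈) of λ where
        (d′ , d′∈ , y∈′) → expand-disjoint d d′ e∈ (All.lookup es∈ d′∈) (All.lookup s d′∈) (All.lookup t d′∈) x∈ y∈′)))

  -- Two darts on one edge either have the same start or follow each other both ways round. Hence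
  -- only the vertices of a closed walk need to be separated by hand.
  closed-walk-edges-distinct : ∀ {u ds} → Walk u ds u → 3 ≤ length ds →
    AllPairs (λ d d′ → dstart d ≢ dstart d′) ds → AllPairs (λ d d′ → edge d ≢ edge d′) ds
  closed-walk-edges-distinct {u} {ds} p ds≥3 starts = lookup-injective⁻ edge distinct
    where
    start-injective : ∀ i j → dstart (lookup ds i) ≡ dstart (lookup ds j) → i ≡ j
    start-injective = lookup-injective dstart starts
    follows : ∀ i j → dend (lookup ds i) ≡ dstart (lookup ds j) → CyclicSucc i j
    follows i j eq with cyclic-succ i
    ... | k , i→k = subst (CyclicSucc i) (start-injective k j (trans (sym (closed-walk p i→k)) eq)) i→k
    same-or-reversed : ∀ d d′ → edge d ≡ edge d′ →
      dstart d ≡ dstart d′ ⊎ (dend d ≡ dstart d′ × dend d′ ≡ dstart d)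
    same-or-reversed (e , true) (.e , true) refl = inj₁ refl
    same-or-reversed (e , false) (.e , false) refl = inj₁ refl
    same-or-reversed (e , true) (.e , false) refl = inj₂ (refl , refl)
    same-or-reversed (e , false) (.e , true) refl = inj₂ (refl , refl)
    distinct : ∀ i j → edge (lookup ds i) ≡ edge (lookup ds j) → i ≡ j
    distinct i j eq with same-or-reversed (lookup ds i) (lookup ds j) eq
    ... | inj₁ h = start-injective i j h
    ... | inj₂ (h , h′) = ⊥-elim (CyclicSucc-no-2-cycle ds≥3 (follows i j h) (follows j i h′))

  length≤sum : ∀ {A : Set} (f : A → ℕ) xs → (∀ x → 1 ≤ f x) → length xs ≤ sum (map f xs)
  length≤sum f [] h = z≤n
  length≤sum f (x ∷ xs) h = +-mono-≤ (h x) (length≤sum f xs h)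

  -- The last component keeps track of the edge on which each vertex lies; this is how the cycle is
  -- later seen to avoid a deleted set.
  closed-walk⇒cycle : (∀ e → 1 ≤ w e) → ∀ {u ds} → Walk u ds u → All (λ d → edge d ∈ es) ds →
    AllPairs (λ d d′ → dstart d ≢ dstart d′) ds → 3 ≤ length ds →
    Σ (Cycle graph) λ C → Cycle.len C ≡ sum (map (w ∘ edge) ds) ×
      (∀ i → ∃[ d ] ∃[ k ] (d ∈ ds × k ≤ w (edge d) × pt (Cycle.vert C i) ≡ vtx (edge d) k))
  closed-walk⇒cycle w≥1 {u} {ds} p ds∈ starts ds≥3 = C , length-expand ds , covered
    where
    xs : List GraphStep
    xs = concatMap expand ds
    xs! : AllPairs StartsDiffer xs
    xs! = expand-all-unique ds∈ starts (closed-walk-edges-distinct p ds≥3 starts)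
    origin : ∀ i → ∃[ d ] (d ∈ ds × lookup xs i ∈ expand d)
    origin i = find (∈-concatMap⁻ expand {xs = ds} (∈-lookup {xs = xs} i))
    slot : ∀ i → IsSlot (proj₁ (lookup xs i))
    slot i = let (d , d∈ , x∈) = origin i ; (k , k< , eq) = ∈-expand-slot d x∈ in
      subst IsSlot (sym eq) (All.lookup ds∈ d∈ , k<)
    point : ∀ x → IsSlot (proj₁ x) → ∃[ i ] pt i ≡ gstart x
    point ((e , k) , true) (e∈ , k<) = index-of e k e∈ (<⇒≤ k<)
    point ((e , k) , false) (e∈ , k<) = index-of e (suc k) e∈ k<
    joins : ∀ x {y} → gend x ≡ y → Joins (proj₁ x) (gstart x) y
    joins (s , true) refl = inj₁ (refl , refl)
    joins (s , false) refl = inj₂ (refl , refl)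
    vertex : Fin (length xs) → Fin (length vs)
    vertex i = proj₁ (point (lookup xs i) (slot i))
    pt-vertex : ∀ i → pt (vertex i) ≡ gstart (lookup xs i)
    pt-vertex i = proj₂ (point (lookup xs i) (slot i))
    C : Cycle graph
    C = record
      { len = length xs
      ; len≥3 = ≤-trans ds≥3 (≤-trans (length≤sum (w ∘ edge) ds (λ d → w≥1 (edge d))) (≤-reflexive (sym (length-expand ds))))
      ; vert = vertex
      ; inj = λ i j eq → lookup-injective gstart xs! i j (trans (sym (pt-vertex i)) (trans (cong pt eq) (pt-vertex j)))
      ; adj = λ i j i→j → slot⇒adjacent (proj₁ (lookup xs i)) (vertex i) (vertex j) (slot i)
          (subst (λ v → Joins (proj₁ (lookup xs i)) v (pt (vertex j))) (sym (pt-vertex i))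
            (joins (lookup xs i) (trans (G.closed-walk (expand-walk p) i→j) (sym (pt-vertex j)))))
      }
    covered : ∀ i → ∃[ d ] ∃[ k ] (d ∈ ds × k ≤ w (edge d) × pt (vertex i) ≡ vtx (edge d) k)
    covered i = case ∈-expand d x∈ of λ where
        (inj₁ h) → let (k , k≤ , r) = dart-point d in d , k , d∈ , k≤ , trans (pt-vertex i) (trans h r)
        (inj₂ (k , _ , k< , h)) → d , k , d∈ , <⇒≤ k< , trans (pt-vertex i) h
      where
      d = proj₁ (origin i)
      d∈ = proj₁ (proj₂ (origin i))
      x∈ = proj₂ (proj₂ (origin i))

-- Subdivided grids in the plane

-- Written with the constructor and denominator 1, so that equality of embedded points can be
-- matched with `refl`.
ι : ℕ → ℚ
ι n = mkℚ (ℤ.+ n) 0 (Coprimality.sym (1-coprimeTo n))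

ι-mono : ∀ {m n} → m ≤ n → ι m ℚ.≤ ι n
ι-mono {m} {n} m≤n = *≤* (ℤₚ.*-monoʳ-≤-nonNeg (ℤ.+ 1) (ℤ.+≤+ m≤n))

ι-cancel-≤ : ∀ {m n} → ι m ℚ.≤ ι n → m ≤ n
ι-cancel-≤ {m} {n} (*≤* h) = ℤₚ.drop‿+≤+ (subst₂ ℤ._≤_ (ℤₚ.*-identityʳ (ℤ.+ m)) (ℤₚ.*-identityʳ (ℤ.+ n)) h)

ι² : ℕ × ℕ → Point
ι² (a , b) = ι a , ι b

ι²-injective : ∀ {u v} → ι² u ≡ ι² v → u ≡ v
ι²-injective refl = refl

module _ {a b l : ℚ} (0≤l : 0ℚ ℚ.≤ l) (l≤1 : l ℚ.≤ 1ℚ) where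

  private
    instance
      l-nonNeg : ℚ.NonNegative l
      l-nonNeg = ℚ.nonNegative 0≤l
      1-l-nonNeg : ℚ.NonNegative (1ℚ ℚ.- l)
      1-l-nonNeg = ℚ.nonNegative (subst (ℚ._≤ 1ℚ ℚ.- l) (ℚₚ.+-inverseʳ l) (ℚₚ.+-monoˡ-≤ (ℚ.- l) l≤1))

    convex : ∀ l a b → a ℚ.+ l ℚ.* (b ℚ.- a) ≡ (1ℚ ℚ.- l) ℚ.* a ℚ.+ l ℚ.* b
    convex = solve 3 (λ l a b → a :+ l :* (b :- a) := (con 1ℚ :- l) :* a :+ l :* b) refl
      where open ℚSolver.+-*-Solver

    constant : ∀ l c → (1ℚ ℚ.- l) ℚ.* c ℚ.+ l ℚ.* c ≡ c
    constant = solve 2 (λ l c → (con 1ℚ :- l) :* c :+ l :* c := c) refl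
      where open ℚSolver.+-*-Solver

  convex-≤ : ∀ {hi} → a ℚ.≤ hi → b ℚ.≤ hi → a ℚ.+ l ℚ.* (b ℚ.- a) ℚ.≤ hi
  convex-≤ {hi} a≤ b≤ = subst₂ ℚ._≤_ (sym (convex l a b)) (constant l hi)
    (ℚₚ.+-mono-≤ (ℚₚ.*-monoˡ-≤-nonNeg (1ℚ ℚ.- l) a≤) (ℚₚ.*-monoˡ-≤-nonNeg l b≤))

  convex-≥ : ∀ {lo} → lo ℚ.≤ a → lo ℚ.≤ b → lo ℚ.≤ a ℚ.+ l ℚ.* (b ℚ.- a)
  convex-≥ {lo} ≤a ≤b = subst₂ ℚ._≤_ (constant l lo) (sym (convex l a b))
    (ℚₚ.+-mono-≤ (ℚₚ.*-monoˡ-≤-nonNeg (1ℚ ℚ.- l) ≤a) (ℚₚ.*-monoˡ-≤-nonNeg l ≤b))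

-- hor c r joins (c , r) to (c + 1 , r), and ver c r joins (c , r) to (c , r + 1).
data GridEdge : Set where
  hor ver : ℕ → ℕ → GridEdge

_≟E_ : DecidableEquality GridEdge
hor c r ≟E hor c′ r′ = map′ (λ { (refl , refl) → refl }) (λ { refl → refl , refl }) ((c ℕ.≟ c′) ×-dec (r ℕ.≟ r′))
ver c r ≟E ver c′ r′ = map′ (λ { (refl , refl) → refl }) (λ { refl → refl , refl }) ((c ℕ.≟ c′) ×-dec (r ℕ.≟ r′))
hor _ _ ≟E ver _ _ = no λ ()
ver _ _ ≟E hor _ _ = no λ ()

_≟P_ : DecidableEquality (ℕ × ℕ)
_≟P_ = ≡-dec ℕ._≟_ ℕ._≟_

*+-mono-< : ∀ {c c′ m k k′} → c < c′ → k < m → c * m + k < c′ * m + k′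
*+-mono-< {c} {c′} {m} {k} {k′} c<c′ k<m = begin-strict
  c * m + k     <⟨ +-monoʳ-< (c * m) k<m ⟩
  c * m + m     ≡⟨ +-comm (c * m) m ⟩
  suc c * m     ≤⟨ *-monoˡ-≤ m c<c′ ⟩
  c′ * m        ≤⟨ m≤m+n _ k′ ⟩
  c′ * m + k′   ∎
  where open ≤-Reasoning

*+-between : ∀ c c′ m k k′ → 0 < k → k < m → k′ ≤ m → c * m + k ≡ c′ * m + k′ → c ≡ c′
*+-between c c′ m k k′ 0<k k<m k′≤m eq with <-cmp c c′
... | tri≈ _ p _ = p
... | tri< p _ _ = ⊥-elim (<-irrefl eq (*+-mono-< p k<m))
... | tri> _ _ p = ⊥-elim (<-irrefl (sym eq) (begin-strict
      c′ * m + k′   ≤⟨ +-monoʳ-≤ (c′ * m) k′≤m ⟩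
      c′ * m + m    ≡⟨ +-comm (c′ * m) m ⟩
      suc c′ * m    ≤⟨ *-monoˡ-≤ m p ⟩
      c * m         <⟨ m<m+n (c * m) 0<k ⟩
      c * m + k     ∎))
  where open ≤-Reasoning

-- Vertex (c , r) of the grid is placed at (c N , r N).  Edges are subdivided at integral points: vertical edges
-- into y pieces of length x, horizontal edges of row r into pieces r pieces of length gap r.
module SubdividedGrid (N x y : ℕ) (y*x : y * x ≡ N) (pieces gap : ℕ → ℕ)
  (pieces*gap : ∀ r → pieces r * gap r ≡ N) {{N≢0 : NonZero N}} where

  w : GridEdge → ℕ
  w (hor c r) = pieces r
  w (ver c r) = y

  vtx : GridEdge → ℕ → ℕ × ℕ
  vtx (hor c r) k = (c * pieces r + k) * gap r , r * N
  vtx (ver c r) k = c * N , (r * y + k) * x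

  instance
    gap-nonZero : ∀ {r} → NonZero (gap r)
    gap-nonZero {r} = m*n≢0⇒n≢0 (pieces r) {{subst NonZero (sym (pieces*gap r)) N≢0}}
    x-nonZero : NonZero x
    x-nonZero = m*n≢0⇒n≢0 y {{subst NonZero (sym y*x) N≢0}}

  column-scale : ∀ c r → c * N ≡ c * pieces r * gap r
  column-scale c r = trans (cong (c *_) (sym (pieces*gap r))) (sym (*-assoc c (pieces r) (gap r)))

  row-scale : ∀ r → r * N ≡ r * y * x
  row-scale r = trans (cong (r *_) (sym y*x)) (sym (*-assoc r y x))

  w≥1 : ∀ e → 1 ≤ w e
  w≥1 (hor c r) = ℕ.>-nonZero⁻¹ (pieces r) {{m*n≢0⇒m≢0 (pieces r) {{subst NonZero (sym (pieces*gap r)) N≢0}}}}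
  w≥1 (ver c r) = ℕ.>-nonZero⁻¹ y {{m*n≢0⇒m≢0 y {{subst NonZero (sym y*x) N≢0}}}}

  vtx-injective : ∀ e j k → vtx e j ≡ vtx e k → j ≡ k
  vtx-injective (hor c r) j k eq = +-cancelˡ-≡ (c * pieces r) j k (*-cancelʳ-≡ _ _ (gap r) (cong proj₁ eq))
  vtx-injective (ver c r) j k eq = +-cancelˡ-≡ (r * y) j k (*-cancelʳ-≡ _ _ x (cong proj₂ eq))

  interior : ∀ e e′ k k′ → 0 < k → k < w e → k′ ≤ w e′ → vtx e k ≡ vtx e′ k′ → e ≡ e′
  interior (hor c r) (hor c′ r′) k k′ 0<k k< k′≤ eq with *-cancelʳ-≡ r r′ N (cong proj₂ eq)
  ... | refl = cong (λ c → hor c r)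
        (*+-between c c′ (pieces r) k k′ 0<k k< k′≤ (*-cancelʳ-≡ _ _ (gap r) (cong proj₁ eq)))
  interior (ver c r) (ver c′ r′) k k′ 0<k k< k′≤ eq with *-cancelʳ-≡ c c′ N (cong proj₁ eq)
  ... | refl = cong (ver c)
        (*+-between r r′ y k k′ 0<k k< k′≤ (*-cancelʳ-≡ _ _ x (cong proj₂ eq)))
  interior (hor c r) (ver c′ r′) k k′ 0<k k< k′≤ eq = ⊥-elim (<-irrefl (sym k≡0) 0<k)
    where
    -- Grid columns lie at multiples of `pieces r * gap r`; dividing by `gap r` shows that a point
    -- on a column has offset k = 0.
    eq′ : c * pieces r + k ≡ c′ * pieces r + 0
    eq′ = trans (*-cancelʳ-≡ _ _ (gap r) (trans (cong proj₁ eq) (column-scale c′ r))) (sym (+-identityʳ _))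
    k≡0 : k ≡ 0
    k≡0 = +-cancelˡ-≡ (c * pieces r) k 0
      (trans eq′ (cong (λ c → c * pieces r + 0) (sym (*+-between c c′ (pieces r) k 0 0<k k< z≤n eq′))))
  interior (ver c r) (hor c′ r′) k k′ 0<k k< k′≤ eq = ⊥-elim (<-irrefl (sym k≡0) 0<k)
    where
    eq′ : r * y + k ≡ r′ * y + 0
    eq′ = trans (*-cancelʳ-≡ _ _ x (trans (cong proj₂ eq) (row-scale r′))) (sym (+-identityʳ _))
    k≡0 : k ≡ 0
    k≡0 = +-cancelˡ-≡ (r * y) k 0 (trans eq′ (cong (λ r → r * y + 0) (sym (*+-between r r′ y k 0 0<k k< z≤n eq′))))

  -- Planarity of the subdivided grid

  module Drawn (es : List GridEdge) (es! : Unique es) where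

    open Subdivision _≟P_ _≟E_ es es! w vtx vtx-injective (λ e e′ k k′ _ _ → interior e e′ k k′) public

    -- Slots are axis-parallel, so the bounding box is the segment itself. Working with boxes leaves
    -- only order comparisons between rationals.
    InBox : Slot → Point → Set
    InBox s (px , py) =
      (ι (proj₁ (lft s)) ℚ.≤ px × px ℚ.≤ ι (proj₁ (rgt s))) × (ι (proj₂ (lft s)) ℚ.≤ py × py ℚ.≤ ι (proj₂ (rgt s)))

    lft≤rgt : ∀ s → proj₁ (lft s) ≤ proj₁ (rgt s) × proj₂ (lft s) ≤ proj₂ (rgt s)
    lft≤rgt (hor c r , k) = *-monoˡ-≤ (gap r) (+-monoʳ-≤ (c * pieces r) (n≤1+n k)) , ≤-refl
    lft≤rgt (ver c r , k) = ≤-refl , *-monoˡ-≤ x (+-monoʳ-≤ (r * y) (n≤1+n k))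

    lft-inBox : ∀ s → InBox s (ι² (lft s))
    lft-inBox s = (ℚₚ.≤-refl , ι-mono (proj₁ (lft≤rgt s))) , (ℚₚ.≤-refl , ι-mono (proj₂ (lft≤rgt s)))

    rgt-inBox : ∀ s → InBox s (ι² (rgt s))
    rgt-inBox s = (ι-mono (proj₁ (lft≤rgt s)) , ℚₚ.≤-refl) , (ι-mono (proj₂ (lft≤rgt s)) , ℚₚ.≤-refl)

    onSeg⇒inBox : ∀ {s u v p} → Joins s u v → OnSeg p (ι² u , ι² v) → InBox s p
    onSeg⇒inBox {s} (inj₁ (refl , refl)) (l , 0≤l , l≤1 , refl , refl) =
      (convex-≥ 0≤l l≤1 ℚₚ.≤-refl X , convex-≤ 0≤l l≤1 X ℚₚ.≤-refl) ,
      (convex-≥ 0≤l l≤1 ℚₚ.≤-refl Y , convex-≤ 0≤l l≤1 Y ℚₚ.≤-refl)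
      where
      X = ι-mono (proj₁ (lft≤rgt s))
      Y = ι-mono (proj₂ (lft≤rgt s))
    onSeg⇒inBox {s} (inj₂ (refl , refl)) (l , 0≤l , l≤1 , refl , refl) =
      (convex-≥ 0≤l l≤1 X ℚₚ.≤-refl , convex-≤ 0≤l l≤1 ℚₚ.≤-refl X) ,
      (convex-≥ 0≤l l≤1 Y ℚₚ.≤-refl , convex-≤ 0≤l l≤1 ℚₚ.≤-refl Y)
      where
      X = ι-mono (proj₁ (lft≤rgt s))
      Y = ι-mono (proj₂ (lft≤rgt s))

    IsEnd : ℕ × ℕ → Slot → Set
    IsEnd v s = v ≡ lft s ⊎ v ≡ rgt s

    between : ∀ {g n} → g ≤ n → n ≤ suc g → n ≡ g ⊎ n ≡ suc g
    between g≤n n≤ with m≤n⇒m<n∨m≡n g≤n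
    ... | inj₁ h = inj₂ (≤-antisym n≤ h)
    ... | inj₂ h = inj₁ (sym h)

    sandwich : ∀ {a b q} → ι a ℚ.≤ q → q ℚ.≤ ι b → a ≤ b
    sandwich p q = ι-cancel-≤ (ℚₚ.≤-trans p q)

    pinned : ∀ {a q} → ι a ℚ.≤ q → q ℚ.≤ ι a → q ≡ ι a
    pinned p q = ℚₚ.≤-antisym q p

    -- The ends of a horizontal piece are consecutive multiples of `gap r`, and every column lies at
    -- a multiple of `gap r` too, so no column passes strictly between them.
    hor-meets-column : ∀ {c r k p} c′ → InBox (hor c r , k) p → proj₁ p ≡ ι (c′ * N) → IsEnd (c′ * N , r * N) (hor c r , k)
    hor-meets-column {c} {r} {k} c′ ((p , q) , _) refl
      with between {c * pieces r + k} {c′ * pieces r}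
             (*-cancelʳ-≤ _ _ (gap r) (≤-trans (ι-cancel-≤ p) (≤-reflexive (column-scale c′ r))))
             (*-cancelʳ-≤ _ _ (gap r) (≤-trans (≤-reflexive (sym (column-scale c′ r)))
               (≤-trans (ι-cancel-≤ q) (≤-reflexive (cong (_* gap r) (+-suc (c * pieces r) k))))))
    ... | inj₁ h = inj₁ (cong (_, r * N) (trans (column-scale c′ r) (cong (_* gap r) h)))
    ... | inj₂ h = inj₂ (cong (_, r * N) (trans (column-scale c′ r) (cong (_* gap r) (trans h (sym (+-suc (c * pieces r) k))))))

    ver-meets-row : ∀ {c r k p} r′ → InBox (ver c r , k) p → proj₂ p ≡ ι (r′ * N) → IsEnd (c * N , r′ * N) (ver c r , k)
    ver-meets-row {c} {r} {k} r′ (_ , (p , q)) refl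
      with between {r * y + k} {r′ * y}
             (*-cancelʳ-≤ _ _ x (≤-trans (ι-cancel-≤ p) (≤-reflexive (row-scale r′))))
             (*-cancelʳ-≤ _ _ x (≤-trans (≤-reflexive (sym (row-scale r′)))
               (≤-trans (ι-cancel-≤ q) (≤-reflexive (cong (_* x) (+-suc (r * y) k))))))
    ... | inj₁ h = inj₁ (cong (c * N ,_) (trans (row-scale r′) (cong (_* x) h)))
    ... | inj₂ h = inj₂ (cong (c * N ,_) (trans (row-scale r′) (cong (_* x) (trans h (sym (+-suc (r * y) k))))))

    touching : ∀ {g g′ d} .{{_ : NonZero d}} {q} → g < g′ → q ℚ.≤ ι (suc g * d) → ι (g′ * d) ℚ.≤ q →
      suc g ≡ g′ × q ≡ ι (suc g * d)
    touching {g} {g′} {d} g<g′ q≤ ≤q with ≤-antisym g<g′ (*-cancelʳ-≤ g′ (suc g) d (sandwich ≤q q≤))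
    ... | refl = refl , pinned ≤q q≤

    Common : Slot → Slot → Point → Set
    Common s s′ p = ∃[ v ] (IsEnd v s × IsEnd v s′ × p ≡ ι² v)

    Common-sym : ∀ s s′ {p} → Common s s′ p → Common s′ s p
    Common-sym s s′ (v , a , b , c) = v , b , a , c

    hor-touch : ∀ c c′ r k k′ p → c * pieces r + k < c′ * pieces r + k′ →
      InBox (hor c r , k) p → InBox (hor c′ r , k′) p → Common (hor c r , k) (hor c′ r , k′) p
    hor-touch c c′ r k k′ p lt ((_ , q≤) , (s≤ , ≤s)) ((≤q , _) , _)
      with touching {d = gap r} lt (subst (λ g → proj₁ p ℚ.≤ ι (g * gap r)) (+-suc (c * pieces r) k) q≤) ≤q
    ... | g≡ , q≡ = rgt (hor c r , k) , inj₂ refl ,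
      inj₁ (cong (λ g → g * gap r , r * N) (trans (+-suc (c * pieces r) k) g≡)) ,
      cong₂ _,_ (trans q≡ (cong (λ g → ι (g * gap r)) (sym (+-suc (c * pieces r) k)))) (pinned s≤ ≤s)

    ver-touch : ∀ c r r′ k k′ p → r * y + k < r′ * y + k′ →
      InBox (ver c r , k) p → InBox (ver c r′ , k′) p → Common (ver c r , k) (ver c r′ , k′) p
    ver-touch c r r′ k k′ p lt ((s≤ , ≤s) , (_ , q≤)) (_ , (≤q , _))
      with touching {d = x} lt (subst (λ g → proj₂ p ℚ.≤ ι (g * x)) (+-suc (r * y) k) q≤) ≤q
    ... | g≡ , q≡ = rgt (ver c r , k) , inj₂ refl ,
      inj₁ (cong (λ g → c * N , g * x) (trans (+-suc (r * y) k) g≡)) ,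
      cong₂ _,_ (pinned s≤ ≤s) (trans q≡ (cong (λ g → ι (g * x)) (sym (+-suc (r * y) k))))

    same-piece : ∀ {m c c′ k k′} → k < m → k′ < m → c * m + k ≡ c′ * m + k′ → c ≡ c′ × k ≡ k′
    same-piece {m} {c} {c′} {k} {k′} k< k′< eq with <-cmp c c′
    ... | tri≈ _ refl _ = refl , +-cancelˡ-≡ (c * m) k k′ eq
    ... | tri< c<c′ _ _ = ⊥-elim (<-irrefl eq (*+-mono-< c<c′ k<))
    ... | tri> _ _ c′<c = ⊥-elim (<-irrefl (sym eq) (*+-mono-< c′<c k′<))

    -- Perpendicular pieces can only meet at a grid corner, which is an end of both. Parallel pieces
    -- that meet are collinear, and then their positions on the line must be consecutive.
    meet : ∀ s s′ p → s ≢ s′ → IsSlot s → IsSlot s′ → InBox s p → InBox s′ p → Common s s′ p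
    meet (hor c r , k) (ver c′ r′ , k′) p _ _ _ b@(_ , (s≤ , ≤s)) b′@((t≤ , ≤t) , _) =
      (c′ * N , r * N) , hor-meets-column {c} {r} {k} {p} c′ b (pinned t≤ ≤t) , ver-meets-row {c′} {r′} {k′} {p} r b′ (pinned s≤ ≤s) ,
      cong₂ _,_ (pinned t≤ ≤t) (pinned s≤ ≤s)
    meet s@(ver c′ r′ , k′) s′@(hor c r , k) p _ _ _ b′@((t≤ , ≤t) , _) b@(_ , (s≤ , ≤s)) =
      (c′ * N , r * N) , ver-meets-row {c′} {r′} {k′} {p} r b′ (pinned s≤ ≤s) , hor-meets-column {c} {r} {k} {p} c′ b (pinned t≤ ≤t) ,
      cong₂ _,_ (pinned t≤ ≤t) (pinned s≤ ≤s)
    meet (hor c r , k) (hor c′ r′ , k′) p s≢s′ (_ , k<) (_ , k′<) b@(_ , (s≤ , ≤s)) b′@(_ , (t≤ , ≤t))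
      with *-cancelʳ-≡ r r′ N (≤-antisym (sandwich s≤ ≤t) (sandwich t≤ ≤s))
    ... | refl with <-cmp (c * pieces r + k) (c′ * pieces r + k′)
    ... | tri< lt _ _ = hor-touch c c′ r k k′ p lt b b′
    ... | tri> _ _ gt = Common-sym (hor c′ r , k′) (hor c r , k) (hor-touch c′ c r k′ k p gt b′ b)
    ... | tri≈ _ eq _ with same-piece {pieces r} {c} {c′} k< k′< eq
    ... | refl , refl = ⊥-elim (s≢s′ refl)
    meet (ver c r , k) (ver c′ r′ , k′) p s≢s′ (_ , k<) (_ , k′<) b@((s≤ , ≤s) , _) b′@((t≤ , ≤t) , _)
      with *-cancelʳ-≡ c c′ N (≤-antisym (sandwich s≤ ≤t) (sandwich t≤ ≤s))
    ... | refl with <-cmp (r * y + k) (r′ * y + k′)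
    ... | tri< lt _ _ = ver-touch c r r′ k k′ p lt b b′
    ... | tri> _ _ gt = Common-sym (ver c r′ , k′) (ver c r , k) (ver-touch c r′ r k′ k p gt b′ b)
    ... | tri≈ _ eq _ with same-piece {y} {r} {r′} k< k′< eq
    ... | refl , refl = ⊥-elim (s≢s′ refl)

    vertex-slot : ∀ i → ∃[ s ] (IsSlot s × IsEnd (pt i) s)
    vertex-slot i with find (∈-concatMap⁻ (λ e → map (vtx e) (upTo (suc (w e)))) {xs = es}
                        (∈-deduplicate⁻ _≟P_ vs₀ (∈-lookup {xs = vs} i)))
    ... | e , e∈ , v∈ with ∈-map⁻ (vtx e) v∈
    ... | zero , _ , eq = (e , 0) , (e∈ , w≥1 e) , inj₁ eq
    ... | suc k , k∈ , eq = (e , k) , (e∈ , ℕ.s≤s⁻¹ (∈-upTo⁻ k∈)) , inj₂ eq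

    _≟S_ : DecidableEquality Slot
    _≟S_ = ≡-dec _≟E_ ℕ._≟_

    end-inBox : ∀ {v s} → IsEnd v s → InBox s (ι² v)
    end-inBox {s = s} (inj₁ refl) = lft-inBox s
    end-inBox {s = s} (inj₂ refl) = rgt-inBox s

    joins-ends : ∀ {s u v} → Joins s u v → IsEnd u s × IsEnd v s
    joins-ends (inj₁ (p , q)) = inj₁ p , inj₂ q
    joins-ends (inj₂ (p , q)) = inj₂ p , inj₁ q

    joins-only : ∀ {s i j v k} → Joins s (pt i) (pt j) → IsEnd v s → pt k ≡ v → k ≡ i ⊎ k ≡ j
    joins-only (inj₁ (p , q)) (inj₁ e) h = inj₁ (pt-injective (trans h (trans e (sym p))))
    joins-only (inj₁ (p , q)) (inj₂ e) h = inj₂ (pt-injective (trans h (trans e (sym q))))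
    joins-only (inj₂ (p , q)) (inj₁ e) h = inj₂ (pt-injective (trans h (trans e (sym q))))
    joins-only (inj₂ (p , q)) (inj₂ e) h = inj₁ (pt-injective (trans h (trans e (sym p))))

    end-vertex : ∀ {s i j v} → Joins s (pt i) (pt j) → IsEnd v s → ∃[ k ] pt k ≡ v
    end-vertex {i = i} (inj₁ (p , q)) (inj₁ e) = i , trans p (sym e)
    end-vertex {j = j} (inj₁ (p , q)) (inj₂ e) = j , trans q (sym e)
    end-vertex {j = j} (inj₂ (p , q)) (inj₁ e) = j , trans q (sym e)
    end-vertex {i = i} (inj₂ (p , q)) (inj₂ e) = i , trans p (sym e)

    joins-same : ∀ {s i j i′ j′} → i Fin.< j → i′ Fin.< j′ → Joins s (pt i) (pt j) → Joins s (pt i′) (pt j′) →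
      (i , j) ≡ (i′ , j′)
    joins-same _ _ (inj₁ (p , q)) (inj₁ (p′ , q′)) =
      cong₂ _,_ (pt-injective (trans p (sym p′))) (pt-injective (trans q (sym q′)))
    joins-same _ _ (inj₂ (p , q)) (inj₂ (p′ , q′)) =
      cong₂ _,_ (pt-injective (trans p (sym p′))) (pt-injective (trans q (sym q′)))
    joins-same i<j i′<j′ (inj₁ (p , q)) (inj₂ (p′ , q′))
      with pt-injective (trans p (sym q′)) | pt-injective (trans q (sym p′))
    ... | refl | refl = ⊥-elim (<-asym i<j i′<j′)
    joins-same i<j i′<j′ (inj₂ (p , q)) (inj₁ (p′ , q′))
      with pt-injective (trans p (sym q′)) | pt-injective (trans q (sym p′))
    ... | refl | refl = ⊥-elim (<-asym i<j i′<j′)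

    -- Every vertex is an end of some slot, so a vertex on an edge is an instance of two slots
    -- meeting.
    box-vertex : ∀ {s i j k} → IsSlot s → Joins s (pt i) (pt j) → InBox s (ι² (pt k)) → k ≡ i ⊎ k ≡ j
    box-vertex {s} {k = k} sl js k∈ =
      let (s′ , sl′ , e′) = vertex-slot k in case s ≟S s′ of λ where
        (yes refl) → joins-only js e′ refl
        (no s≢s′) → let (v , e , _ , eq) = meet s s′ _ s≢s′ sl sl′ k∈ (end-inBox e′) in joins-only js e (ι²-injective eq)

    box-meet : ∀ {s s′ i j i′ j′ p} → i Fin.< j → i′ Fin.< j′ → ¬ ((i , j) ≡ (i′ , j′)) →
      IsSlot s → IsSlot s′ → Joins s (pt i) (pt j) → Joins s′ (pt i′) (pt j′) → InBox s p → InBox s′ p →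
      ∃[ k ] (p ≡ ι² (pt k) × (k ≡ i ⊎ k ≡ j) × (k ≡ i′ ⊎ k ≡ j′))
    box-meet {s} {s′} {p = p} i<j i′<j′ distinct sl sl′ js js′ b b′ = case s ≟S s′ of λ where
      (yes refl) → ⊥-elim (distinct (joins-same i<j i′<j′ js js′))
      (no s≢s′) → let (v , e , e′ , eq) = meet s s′ p s≢s′ sl sl′ b b′ ; (k , k≡) = end-vertex js e in
        k , trans eq (cong ι² (sym k≡)) , joins-only js e k≡ , joins-only js′ e′ k≡

    onPath⇒inBox : ∀ {s i j p} → Joins s (pt i) (pt j) → OnPath p (ι² (pt i) ∷ ι² (pt j) ∷ []) → InBox s p
    onPath⇒inBox js (inj₁ h) = onSeg⇒inBox js h
    onPath⇒inBox js (inj₂ refl) = end-inBox (proj₂ (joins-ends js))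

    planar : Planar graph
    planar = record
      { pos = λ i → ι² (pt i)
      ; bends = λ _ _ → []
      ; pos-inj = λ i j eq → pt-injective (ι²-injective eq)
      ; arc-simple = λ { _ zero zero () }
      ; no-vertex-inside = λ { ((i , j) , _ , adj) k h →
          let (s , sl , js) = adjacent⇒slot i j adj in box-vertex sl js (onPath⇒inBox js h) }
      ; arcs-disjoint = λ { ((i , j) , i<j , adj) ((i′ , j′) , i′<j′ , adj′) distinct p h h′ →
          let (s , sl , js) = adjacent⇒slot i j adj
              (s′ , sl′ , js′) = adjacent⇒slot i′ j′ adj′
          in box-meet i<j i′<j′ distinct sl sl′ js js′ (onPath⇒inBox js h) (onPath⇒inBox js′ h′) }
      }

-- Boundaries of strips in the grid

GridDart : Set
GridDart = GridEdge × Bool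

from to : GridDart → ℕ × ℕ
from (hor c r , true) = c , r
from (hor c r , false) = suc c , r
from (ver c r , true) = c , r
from (ver c r , false) = c , suc r
to (e , b) = from (e , not b)

open Walks from to public

cast : ∀ {u u′ v v′ ds} → u ≡ u′ → v ≡ v′ → Walk u ds v → Walk u′ ds v′
cast refl refl p = p

-- All four are named by their least corner: `left` and `down` start at the far end, `n + c` or
-- `n + r`, and return to it.
right left up down : ℕ → ℕ → ℕ → List GridDart
right c r zero = []
right c r (suc n) = (hor c r , true) ∷ right (suc c) r n
left c r zero = []
left c r (suc n) = (hor (n + c) r , false) ∷ left c r n
up c r zero = []
up c r (suc n) = (ver c r , true) ∷ up c (suc r) n
down c r zero = []
down c r (suc n) = (ver c (n + r) , false) ∷ down c r n

right-walk : ∀ c r n → Walk (c , r) (right c r n) (n + c , r)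
right-walk c r zero = []
right-walk c r (suc n) = step _ refl (cast refl (cong (_, r) (+-suc n c)) (right-walk (suc c) r n))

left-walk : ∀ c r n → Walk (n + c , r) (left c r n) (c , r)
left-walk c r zero = []
left-walk c r (suc n) = step _ refl (left-walk c r n)

up-walk : ∀ c r n → Walk (c , r) (up c r n) (c , n + r)
up-walk c r zero = []
up-walk c r (suc n) = step _ refl (cast refl (cong (c ,_) (+-suc n r)) (up-walk c (suc r) n))

down-walk : ∀ c r n → Walk (c , n + r) (down c r n) (c , r)
down-walk c r zero = []
down-walk c r (suc n) = step _ refl (down-walk c r n)

module _ {P : GridDart → Set} where

  all-right : ∀ c r n → (∀ i → c ≤ i → i < n + c → P (hor i r , true)) → All P (right c r n)
  all-right c r zero h = []
  all-right c r (suc n) h = h c ≤-refl (s≤s (m≤n+m c n)) ∷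
    all-right (suc c) r n (λ i c<i i< → h i (<⇒≤ c<i) (subst (i <_) (+-suc n c) i<))

  all-left : ∀ c r n → (∀ i → c ≤ i → i < n + c → P (hor i r , false)) → All P (left c r n)
  all-left c r zero h = []
  all-left c r (suc n) h = h (n + c) (m≤n+m c n) ≤-refl ∷ all-left c r n (λ i c≤i i< → h i c≤i (m≤n⇒m≤1+n i<))

  all-up : ∀ c r n → (∀ i → r ≤ i → i < n + r → P (ver c i , true)) → All P (up c r n)
  all-up c r zero h = []
  all-up c r (suc n) h = h r ≤-refl (s≤s (m≤n+m r n)) ∷
    all-up c (suc r) n (λ i r<i i< → h i (<⇒≤ r<i) (subst (i <_) (+-suc n r) i<))

  all-down : ∀ c r n → (∀ i → r ≤ i → i < n + r → P (ver c i , false)) → All P (down c r n)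
  all-down c r zero h = []
  all-down c r (suc n) h = h (n + r) (m≤n+m r n) ≤-refl ∷ all-down c r n (λ i r≤i i< → h i r≤i (m≤n⇒m≤1+n i<))

infixr 5 _++ᴬ_
_++ᴬ_ : ∀ {P : GridDart → Set} {xs ys} → All P xs → All P ys → All P (xs ++ ys)
_++ᴬ_ = Allₚ.++⁺

StartsDistinct : List GridDart → Set
StartsDistinct = AllPairs (λ d d′ → from d ≢ from d′)

right-distinct : ∀ c r n → StartsDistinct (right c r n)
right-distinct c r zero = []
right-distinct c r (suc n) = all-right (suc c) r n (λ i c<i _ eq → <-irrefl (cong proj₁ eq) c<i) ∷ right-distinct (suc c) r n

left-distinct : ∀ c r n → StartsDistinct (left c r n)
left-distinct c r zero = []
left-distinct c r (suc n) = all-left c r n (λ i _ i< eq → <-irrefl (sym (suc-injective (cong proj₁ eq))) i<) ∷ left-distinct c r n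

up-distinct : ∀ c r n → StartsDistinct (up c r n)
up-distinct c r zero = []
up-distinct c r (suc n) = all-up c (suc r) n (λ i r<i _ eq → <-irrefl (cong proj₂ eq) r<i) ∷ up-distinct c (suc r) n

down-distinct : ∀ c r n → StartsDistinct (down c r n)
down-distinct c r zero = []
down-distinct c r (suc n) = all-down c r n (λ i _ i< eq → <-irrefl (sym (suc-injective (cong proj₂ eq))) i<) ∷ down-distinct c r n

col row : GridDart → ℕ
col d = proj₁ (from d)
row d = proj₂ (from d)

-- P and Q describe two sides of a cut, usually a row or column line. The boundary is cut in this
-- way until only straight segments remain.
++-distinct : ∀ (P Q : GridDart → Set) → (∀ {d d′} → P d → Q d′ → from d ≢ from d′) →
  ∀ {ds ds′} → All P ds → All Q ds′ → StartsDistinct ds → StartsDistinct ds′ → StartsDistinct (ds ++ ds′)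
++-distinct P Q sep ps qs u u′ = AllPairsₚ.++⁺ u u′ (All.map (λ p → All.map (λ q → sep p q) qs) ps)

by-col : ∀ b {d d′} → col d < b → b ≤ col d′ → from d ≢ from d′
by-col b p q eq = <-irrefl (cong proj₁ eq) (<-≤-trans p q)

by-col′ : ∀ b {d d′} → b ≤ col d → col d′ < b → from d ≢ from d′
by-col′ b p q eq = by-col b q p (sym eq)

by-row : ∀ b {d d′} → row d < b → b ≤ row d′ → from d ≢ from d′
by-row b p q eq = <-irrefl (cong proj₂ eq) (<-≤-trans p q)

by-row′ : ∀ b {d d′} → b ≤ row d → row d′ < b → from d ≢ from d′
by-row′ b p q eq = by-row b q p (sym eq)

count : Bool → List Bool → ℕ
count b [] = 0
count true (true ∷ bs) = suc (count true bs)
count true (false ∷ bs) = count true bs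
count false (true ∷ bs) = count false bs
count false (false ∷ bs) = suc (count false bs)

count-total : ∀ bs → count true bs + count false bs ≡ length bs
count-total [] = refl
count-total (true ∷ bs) = cong suc (count-total bs)
count-total (false ∷ bs) = trans (+-suc _ _) (cong suc (count-total bs))

Marked : (ℕ → Set) → List Bool → ℕ → Set
Marked U [] j = ⊤
Marked U (f ∷ fs) j = (f ≡ true → U j) × Marked U fs (suc j)

-- The boundary of the strip between rows b and b + 1, enlarged in every unit j marked true by the full-height
-- column of cells between columns j κ + 1 and j κ + 2.  Its length does not depend on b, since a full-height
-- column is extended by h above the strip and by b below it, and h + b is fixed.
module Strip (κ′ h b : ℕ) where

  κ R : ℕ
  -- Width 3 leaves a column of cells on each side of the full-height one, so the enlargements of
  -- neighbouring units do not touch.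
  κ = 3 + κ′
  R = h + suc b

  top-block bottom-block : Bool → ℕ → List GridDart
  top-block false c = right c (suc b) κ
  top-block true c = right c (suc b) 1 ++ up (1 + c) (suc b) h ++ (hor (1 + c) R , true) ∷
    down (2 + c) (suc b) h ++ right (2 + c) (suc b) (1 + κ′)
  bottom-block false c = left c b κ
  bottom-block true c = left (2 + c) b (1 + κ′) ++ down (2 + c) 0 b ++ (hor (1 + c) 0 , false) ∷
    up (1 + c) 0 b ++ left c b 1

  top bottom : List Bool → ℕ → List GridDart
  top [] j = []
  top (f ∷ fs) j = top-block f (j * κ) ++ top fs (suc j)
  bottom [] j = []
  bottom (f ∷ fs) j = bottom fs (suc j) ++ bottom-block f (j * κ)

  boundary : List Bool → List GridDart
  boundary fs = (ver 0 b , true) ∷ top fs 0 ++ (ver (length fs * κ) b , false) ∷ bottom fs 0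

  tail-end : ∀ c → 1 + κ′ + (2 + c) ≡ κ + c
  tail-end c = trans (+-suc (1 + κ′) (1 + c)) (cong suc (+-suc (1 + κ′) c))

  top-block-walk : ∀ f c → Walk (c , suc b) (top-block f c) (κ + c , suc b)
  top-block-walk false c = right-walk c (suc b) κ
  top-block-walk true c = right-walk c (suc b) 1 ++ʷ up-walk (1 + c) (suc b) h ++ʷ
    step _ refl (down-walk (2 + c) (suc b) h ++ʷ
      cast refl (cong (_, suc b) (tail-end c)) (right-walk (2 + c) (suc b) (1 + κ′)))

  bottom-block-walk : ∀ f c → Walk (κ + c , b) (bottom-block f c) (c , b)
  bottom-block-walk false c = left-walk c b κ
  bottom-block-walk true c = cast (cong (_, b) (tail-end c)) refl (left-walk (2 + c) b (1 + κ′)) ++ʷ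
    cast (cong (2 + c ,_) (+-identityʳ b)) refl (down-walk (2 + c) 0 b) ++ʷ
    step _ refl (cast refl (cong (1 + c ,_) (+-identityʳ b)) (up-walk (1 + c) 0 b) ++ʷ left-walk c b 1)

  shift : ∀ (fs : List Bool) j → (length fs + suc j) * κ ≡ (suc (length fs) + j) * κ
  shift fs j = cong (_* κ) (+-suc (length fs) j)

  top-walk : ∀ fs j → Walk (j * κ , suc b) (top fs j) ((length fs + j) * κ , suc b)
  top-walk [] j = []
  top-walk (f ∷ fs) j = top-block-walk f (j * κ) ++ʷ cast refl (cong (_, suc b) (shift fs j)) (top-walk fs (suc j))

  bottom-walk : ∀ fs j → Walk ((length fs + j) * κ , b) (bottom fs j) (j * κ , b)
  bottom-walk [] j = []
  bottom-walk (f ∷ fs) j = cast (cong (_, b) (shift fs j)) refl (bottom-walk fs (suc j)) ++ʷ bottom-block-walk f (j * κ)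

  boundary-walk : ∀ fs → Walk (0 , b) (boundary fs) (0 , b)
  boundary-walk fs = step _ refl (cast refl (cong (_, suc b) (cong (_* κ) (+-identityʳ (length fs)))) (top-walk fs 0) ++ʷ
    step _ refl (cast (cong (_, b) (cong (_* κ) (+-identityʳ (length fs)))) refl (bottom-walk fs 0)))

  -- Half-open on opposite sides, since only starts are recorded and the top is run rightwards, the
  -- bottom leftwards.
  InTop InBottom : ℕ → ℕ → GridDart → Set
  InTop c c′ d = (c ≤ col d × col d < c′) × suc b ≤ row d
  InBottom c c′ d = (c < col d × col d ≤ c′) × row d ≤ b

  c<κ+c : ∀ c → c < κ + c
  c<κ+c c = s≤s (m≤n+m c (2 + κ′))

  in-tail : ∀ {i} c → i < 1 + κ′ + (2 + c) → i < κ + c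
  in-tail c i< = ≤-trans i< (≤-reflexive (tail-end c))

  top-block-region : ∀ f c → All (InTop c (κ + c)) (top-block f c)
  top-block-region false c = all-right c (suc b) κ (λ i p q → (p , q) , ≤-refl)
  top-block-region true c =
    (((≤-refl , c<κ+c c) , ≤-refl) ∷ []) ++ᴬ
    all-up (1 + c) (suc b) h (λ i p q → ((n≤1+n c , s≤s (s≤s (m≤n+m c (1 + κ′)))) , p)) ++ᴬ
    ((n≤1+n c , s≤s (s≤s (m≤n+m c (1 + κ′)))) , m≤n+m (suc b) h) ∷
    all-down (2 + c) (suc b) h (λ i p q → ((m≤n+m c 2 , s≤s (s≤s (s≤s (m≤n+m c κ′)))) , m≤n⇒m≤1+n p)) ++ᴬ
    all-right (2 + c) (suc b) (1 + κ′) (λ i p q → (≤-trans (m≤n+m c 2) p , in-tail c q) , ≤-refl)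

  bottom-block-region : ∀ f c → All (InBottom c (κ + c)) (bottom-block f c)
  bottom-block-region false c = all-left c b κ (λ i p q → (s≤s p , q) , ≤-refl)
  bottom-block-region true c =
    all-left (2 + c) b (1 + κ′) (λ i p q → (s≤s (≤-trans (m≤n+m c 2) p) , in-tail c q) , ≤-refl) ++ᴬ
    all-down (2 + c) 0 b (λ i p q → (s≤s (n≤1+n c) , s≤s (s≤s (m≤n+m c (1 + κ′)))) , ≤-trans q (≤-reflexive (+-identityʳ b))) ++ᴬ
    ((s≤s (n≤1+n c) , s≤s (s≤s (m≤n+m c (1 + κ′)))) , z≤n) ∷
    all-up (1 + c) 0 b (λ i p q → (≤-refl , s≤s (m≤n+m c (2 + κ′))) , <⇒≤ (≤-trans q (≤-reflexive (+-identityʳ b)))) ++ᴬ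
    ((≤-refl , s≤s (m≤n+m c (2 + κ′))) , ≤-refl) ∷ []

  top-block-distinct : ∀ f c → StartsDistinct (top-block f c)
  top-block-distinct false c = right-distinct c (suc b) κ
  top-block-distinct true c =
    ++-distinct (λ d → col d < 1 + c) (λ d → 1 + c ≤ col d) (by-col (1 + c))
      (≤-refl ∷ [])
      (Allₚ.++⁺ (all-up (1 + c) (suc b) h (λ i p q → ≤-refl)) (≤-refl ∷ All.map <⇒≤ after))
      ([] ∷ []) (
    -- The ascending side starts only below row R; what follows starts in row R or further right.
    ++-distinct (λ d → col d < 2 + c × row d < R) (λ d → R ≤ row d ⊎ 2 + c ≤ col d)
      (λ { {d} {d′} (p , q) (inj₁ r) → by-row R {d} {d′} q r ; {d} {d′} (p , q) (inj₂ r) → by-col (2 + c) {d} {d′} p r })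
      (all-up (1 + c) (suc b) h (λ i p q → ≤-refl , q))
      (inj₁ ≤-refl ∷ All.map inj₂ after)
      (up-distinct (1 + c) (suc b) h) (
    All.map (λ {d} p → by-col (2 + c) {hor (1 + c) R , true} {d} ≤-refl p) after ∷
    ++-distinct (λ d → 2 + b ≤ row d) (λ d → row d < 2 + b) (by-row′ (2 + b))
      (all-down (2 + c) (suc b) h (λ i p q → s≤s p))
      (all-right (2 + c) (suc b) (1 + κ′) (λ i p q → ≤-refl))
      (down-distinct (2 + c) (suc b) h) (right-distinct (2 + c) (suc b) (1 + κ′))))
    where
    after : All (λ d → 2 + c ≤ col d) (down (2 + c) (suc b) h ++ right (2 + c) (suc b) (1 + κ′))
    after = Allₚ.++⁺ (all-down (2 + c) (suc b) h (λ i p q → ≤-refl)) (all-right (2 + c) (suc b) (1 + κ′) (λ i p q → p))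

  bottom-block-distinct : ∀ f c → StartsDistinct (bottom-block f c)
  bottom-block-distinct false c = left-distinct c b κ
  bottom-block-distinct true c =
    ++-distinct (λ d → 3 + c ≤ col d) (λ d → col d < 3 + c) (by-col′ (3 + c))
      (all-left (2 + c) b (1 + κ′) (λ i p q → s≤s p))
      (Allₚ.++⁺ (all-down (2 + c) 0 b (λ i p q → ≤-refl)) (≤-refl ∷ All.map m≤n⇒m≤1+n after))
      (left-distinct (2 + c) b (1 + κ′)) (
    ++-distinct (λ d → 2 + c ≤ col d × 1 ≤ row d) (λ d → row d < 1 ⊎ col d < 2 + c)
      (λ { {d} {d′} (p , q) (inj₁ r) → by-row′ 1 {d} {d′} q r ; {d} {d′} (p , q) (inj₂ r) → by-col′ (2 + c) {d} {d′} p r })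
      (all-down (2 + c) 0 b (λ i p q → ≤-refl , s≤s z≤n))
      (inj₁ ≤-refl ∷ All.map inj₂ after)
      (down-distinct (2 + c) 0 b) (
    All.map (λ {d} p → by-col′ (2 + c) {hor (1 + c) 0 , false} {d} ≤-refl p) after ∷
    ++-distinct (λ d → row d < b) (λ d → b ≤ row d) (by-row b)
      (all-up (1 + c) 0 b (λ i p q → ≤-trans q (≤-reflexive (+-identityʳ b))))
      (≤-refl ∷ [])
      (up-distinct (1 + c) 0 b) ([] ∷ [])))
    where
    after : All (λ d → col d < 2 + c) (up (1 + c) 0 b ++ left c b 1)
    after = Allₚ.++⁺ (all-up (1 + c) 0 b (λ i p q → ≤-refl)) (≤-refl ∷ [])

  top-region : ∀ fs j → All (InTop (j * κ) ((length fs + j) * κ)) (top fs j)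
  top-region [] j = []
  top-region (f ∷ fs) j = Allₚ.++⁺
    (All.map (λ { ((p , q) , r) → (p , ≤-trans q (*-monoˡ-≤ κ (≤-trans (m≤n+m (suc j) (length fs)) (≤-reflexive (+-suc (length fs) j))))) , r }) (top-block-region f (j * κ)))
    (All.map (λ { ((p , q) , r) → (≤-trans (m≤n+m (j * κ) κ) p , ≤-trans q (≤-reflexive (shift fs j))) , r }) (top-region fs (suc j)))

  bottom-region : ∀ fs j → All (InBottom (j * κ) ((length fs + j) * κ)) (bottom fs j)
  bottom-region [] j = []
  bottom-region (f ∷ fs) j = Allₚ.++⁺
    (All.map (λ { ((p , q) , r) → (≤-<-trans (m≤n+m (j * κ) κ) p , ≤-trans q (≤-reflexive (shift fs j))) , r }) (bottom-region fs (suc j)))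
    (All.map (λ { ((p , q) , r) → (p , ≤-trans q (*-monoˡ-≤ κ (≤-trans (m≤n+m (suc j) (length fs)) (≤-reflexive (+-suc (length fs) j))))) , r }) (bottom-block-region f (j * κ)))

  top-distinct : ∀ fs j → StartsDistinct (top fs j)
  top-distinct [] j = []
  top-distinct (f ∷ fs) j =
    ++-distinct (λ d → col d < suc j * κ) (λ d → suc j * κ ≤ col d) (by-col (suc j * κ))
      (All.map (proj₂ ∘ proj₁) (top-block-region f (j * κ))) (All.map (proj₁ ∘ proj₁) (top-region fs (suc j)))
      (top-block-distinct f (j * κ)) (top-distinct fs (suc j))

  bottom-distinct : ∀ fs j → StartsDistinct (bottom fs j)
  bottom-distinct [] j = []
  bottom-distinct (f ∷ fs) j =
    ++-distinct (λ d → suc (suc j * κ) ≤ col d) (λ d → col d < suc (suc j * κ)) (by-col′ (suc (suc j * κ)))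
      (All.map (proj₁ ∘ proj₁) (bottom-region fs (suc j))) (All.map (s≤s ∘ proj₂ ∘ proj₁) (bottom-block-region f (j * κ)))
      (bottom-distinct fs (suc j)) (bottom-block-distinct f (j * κ))

  boundary-distinct : ∀ fs → StartsDistinct (boundary fs)
  boundary-distinct fs =
    Allₚ.++⁺ (All.map (λ {d} h → by-row (suc b) {ver 0 b , true} {d} ≤-refl (proj₂ h)) (top-region fs 0))
      (by-row (suc b) {ver 0 b , true} {ver (length fs * κ) b , false} ≤-refl ≤-refl ∷
       All.map (λ {d} h → by-col 1 {ver 0 b , true} {d} ≤-refl (proj₁ (proj₁ h))) (bottom-region fs 0)) ∷
    ++-distinct (λ d → col d < length fs * κ × suc b ≤ row d) (λ d → length fs * κ ≤ col d ⊎ row d < suc b)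
      (λ { {d} {d′} (p , q) (inj₁ r) → by-col (length fs * κ) {d} {d′} p r ; {d} {d′} (p , q) (inj₂ r) → by-row′ (suc b) {d} {d′} q r })
      (All.map (λ { ((p , q) , r) → ≤-trans q (≤-reflexive (cong (_* κ) (+-identityʳ (length fs)))) , r }) (top-region fs 0))
      (inj₁ ≤-refl ∷ All.map (inj₂ ∘ s≤s ∘ proj₂) (bottom-region fs 0))
      (top-distinct fs 0)
      (All.map (λ {d} h → by-row′ (suc b) {ver (length fs * κ) b , false} {d} ≤-refl (s≤s (proj₂ h))) (bottom-region fs 0) ∷ bottom-distinct fs 0)

  -- Edges of the boundary

  module _ (U : ℕ → Set) (M : ℕ) (b<R : suc b < R) where

    -- The first two kinds lie on the strip, the others in a unit satisfying `U`. The bounds keep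
    -- the latter strictly before the first column of the next unit, so that dividing the abscissa
    -- returns j even at the far end.
    data BoundaryEdge : GridEdge → Set where
      strip-hor : ∀ {c r} → c < M * κ → r ≡ b ⊎ r ≡ suc b → BoundaryEdge (hor c r)
      strip-ver : ∀ {c} → c ≤ M * κ → BoundaryEdge (ver c b)
      unit-hor : ∀ {j c r} → U j → j < M → r < R → j * κ ≤ c → suc c < suc j * κ → BoundaryEdge (hor c r)
      unit-ver : ∀ {j c r} → U j → j < M → r < R → j * κ ≤ c → c < suc j * κ → BoundaryEdge (ver c r)
      heavy : ∀ {j} → U j → j < M → BoundaryEdge (hor (suc (j * κ)) R)

    Good : GridDart → Set
    Good d = BoundaryEdge (proj₁ d)

    module _ (j : ℕ) (j<M : j < M) where

      private
        c = j * κ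

      inM : ∀ {i} → i < κ + c → i < M * κ
      inM i< = ≤-trans i< (*-monoˡ-≤ κ j<M)

      top-block-good : ∀ f → (f ≡ true → U j) → All Good (top-block f c)
      top-block-good false _ = all-right c (suc b) κ (λ i p q → strip-hor (inM q) (inj₂ refl))
      top-block-good true u =
        (strip-hor (inM (c<κ+c c)) (inj₂ refl) ∷ []) ++ᴬ
        all-up (1 + c) (suc b) h (λ i p q → unit-ver (u refl) j<M q (n≤1+n c) (s≤s (s≤s (m≤n+m c (1 + κ′))))) ++ᴬ
        heavy (u refl) j<M ∷
        all-down (2 + c) (suc b) h (λ i p q → unit-ver (u refl) j<M q (m≤n+m c 2) (s≤s (s≤s (s≤s (m≤n+m c κ′))))) ++ᴬ
        all-right (2 + c) (suc b) (1 + κ′) (λ i p q → strip-hor (inM (in-tail c q)) (inj₂ refl))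

      below-strip : ∀ {i} → i < b + 0 → i < R
      below-strip i< = ≤-trans i< (≤-trans (≤-reflexive (+-identityʳ b)) (≤-trans (n≤1+n b) (<⇒≤ b<R)))

      bottom-block-good : ∀ f → (f ≡ true → U j) → All Good (bottom-block f c)
      bottom-block-good false _ = all-left c b κ (λ i p q → strip-hor (inM q) (inj₁ refl))
      bottom-block-good true u =
        all-left (2 + c) b (1 + κ′) (λ i p q → strip-hor (inM (in-tail c q)) (inj₁ refl)) ++ᴬ
        all-down (2 + c) 0 b (λ i p q → unit-ver (u refl) j<M (below-strip q) (m≤n+m c 2) (s≤s (s≤s (s≤s (m≤n+m c κ′))))) ++ᴬ
        unit-hor (u refl) j<M (≤-<-trans z≤n b<R) (n≤1+n c) (s≤s (s≤s (s≤s (m≤n+m c κ′)))) ∷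
        all-up (1 + c) 0 b (λ i p q → unit-ver (u refl) j<M (below-strip q) (n≤1+n c) (s≤s (s≤s (m≤n+m c (1 + κ′))))) ++ᴬ
        strip-hor (inM (c<κ+c c)) (inj₁ refl) ∷ []

    top-good : ∀ fs j → length fs + j ≡ M → Marked U fs j → All Good (top fs j)
    top-good [] j _ _ = []
    top-good (f ∷ fs) j eq (u , us) = top-block-good j (subst (j <_) eq (s≤s (m≤n+m j (length fs)))) f u ++ᴬ
      top-good fs (suc j) (trans (+-suc (length fs) j) eq) us

    bottom-good : ∀ fs j → length fs + j ≡ M → Marked U fs j → All Good (bottom fs j)
    bottom-good [] j _ _ = []
    bottom-good (f ∷ fs) j eq (u , us) = bottom-good fs (suc j) (trans (+-suc (length fs) j) eq) us ++ᴬ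
      bottom-block-good j (subst (j <_) eq (s≤s (m≤n+m j (length fs)))) f u

    boundary-good : ∀ fs → length fs ≡ M → Marked U fs 0 → All Good (boundary fs)
    boundary-good fs refl us = strip-ver z≤n ∷ top-good fs 0 (+-identityʳ _) us ++ᴬ
      strip-ver ≤-refl ∷ bottom-good fs 0 (+-identityʳ _) us

  -- Length of the boundary

  module _ (w : GridEdge → ℕ) (x y : ℕ) (w-ver : ∀ c r → w (ver c r) ≡ y)
    (w-hor : ∀ c r → r < R → w (hor c r) ≡ y) (w-heavy : ∀ c → w (hor c R) ≡ x) (b<R : suc b < R) where

    total : List GridDart → ℕ
    total ds = sum (map (w ∘ proj₁) ds)

    total-++ : ∀ ds ds′ {m n} → total ds ≡ m → total ds′ ≡ n → total (ds ++ ds′) ≡ m + n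
    total-++ ds ds′ refl refl = trans (cong sum (map-++ (w ∘ proj₁) ds ds′)) (sum-++ (map (w ∘ proj₁) ds) (map (w ∘ proj₁) ds′))

    total-right : ∀ c r n → r < R → total (right c r n) ≡ n * y
    total-right c r zero r< = refl
    total-right c r (suc n) r< = cong₂ _+_ (w-hor c r r<) (total-right (suc c) r n r<)

    total-left : ∀ c r n → r < R → total (left c r n) ≡ n * y
    total-left c r zero r< = refl
    total-left c r (suc n) r< = cong₂ _+_ (w-hor (n + c) r r<) (total-left c r n r<)

    total-up : ∀ c r n → total (up c r n) ≡ n * y
    total-up c r zero = refl
    total-up c r (suc n) = cong₂ _+_ (w-ver c r) (total-up c (suc r) n)

    total-down : ∀ c r n → total (down c r n) ≡ n * y
    total-down c r zero = refl
    total-down c r (suc n) = cong₂ _+_ (w-ver c (n + r)) (total-down c r n)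

    private
      b<R′ : b < R
      b<R′ = <⇒≤ b<R
      top-cost bottom-cost : ℕ
      top-cost = 1 * y + (h * y + (x + (h * y + (1 + κ′) * y)))
      bottom-cost = (1 + κ′) * y + (b * y + (y + (b * y + 1 * y)))

    total-top : ∀ fs j → total (top fs j) ≡ count true fs * top-cost + count false fs * (κ * y)
    total-top [] j = refl
    total-top (false ∷ fs) j = trans
      (total-++ (top-block false (j * κ)) (top fs (suc j)) (total-right (j * κ) (suc b) κ b<R) (total-top fs (suc j)))
      (lem (κ * y) (count true fs * top-cost) (count false fs * (κ * y)))
      where
      lem : ∀ a u v → a + (u + v) ≡ u + (a + v)
      lem = solve-∀
    total-top (true ∷ fs) j = trans
      (total-++ (top-block true c) (top fs (suc j))
        (total-++ (right c (suc b) 1) (up (1 + c) (suc b) h ++ (hor (1 + c) R , true) ∷ end) (total-right c (suc b) 1 b<R)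
          (total-++ (up (1 + c) (suc b) h) ((hor (1 + c) R , true) ∷ end) (total-up (1 + c) (suc b) h)
            (cong₂ _+_ (w-heavy (1 + c))
              (total-++ (down (2 + c) (suc b) h) (right (2 + c) (suc b) (1 + κ′)) (total-down (2 + c) (suc b) h) (total-right (2 + c) (suc b) (1 + κ′) b<R)))))
        (total-top fs (suc j)))
      (sym (+-assoc top-cost _ _))
      where
      c = j * κ
      end = down (2 + c) (suc b) h ++ right (2 + c) (suc b) (1 + κ′)

    total-bottom : ∀ fs j → total (bottom fs j) ≡ count true fs * bottom-cost + count false fs * (κ * y)
    total-bottom [] j = refl
    total-bottom (false ∷ fs) j = trans
      (total-++ (bottom fs (suc j)) (bottom-block false (j * κ)) (total-bottom fs (suc j)) (total-left (j * κ) b κ b<R′))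
      (lem (κ * y) (count true fs * bottom-cost) (count false fs * (κ * y)))
      where
      lem : ∀ a u v → u + v + a ≡ u + (a + v)
      lem = solve-∀
    total-bottom (true ∷ fs) j = trans
      (total-++ (bottom fs (suc j)) (bottom-block true c) (total-bottom fs (suc j))
        (total-++ (left (2 + c) b (1 + κ′)) _ (total-left (2 + c) b (1 + κ′) b<R′)
          (total-++ (down (2 + c) 0 b) _ (total-down (2 + c) 0 b)
            (cong₂ _+_ (w-hor (1 + c) 0 (≤-<-trans z≤n b<R))
              (total-++ (up (1 + c) 0 b) _ (total-up (1 + c) 0 b) (total-left c b 1 b<R′))))))
      (lem bottom-cost (count true fs * bottom-cost) (count false fs * (κ * y)))
      where
      c = j * κ
      lem : ∀ a u v → u + v + a ≡ a + u + v
      lem = solve-∀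

    -- In light edges, the two ends cost 2, each marked unit 5 + 2 κ′ + 2 (h + b), and each of the s
    -- unmarked ones 2 κ. As 2 + 2 κ s = 1 + a, the coefficient of y becomes 1 plus a multiple of a.
    total-boundary : ∀ fs s → h + b ≡ 2 * s + 1 → count true fs ≡ 2 * κ * s + 1 → count false fs ≡ s →
      total (boundary fs) ≡ (2 * κ * s + 1) * x + (1 + (2 * κ * s + 1) * (2 * κ′ + 4 * s + 8)) * y
    total-boundary fs s h+b ct cf = begin
      total (boundary fs)
        ≡⟨ cong₂ _+_ (w-ver 0 b) (total-++ (top fs 0) _ (total-top fs 0)
             (cong₂ _+_ (w-ver (length fs * κ) b) (total-bottom fs 0))) ⟩
      y + (count true fs * top-cost + count false fs * (κ * y) + (y + (count true fs * bottom-cost + count false fs * (κ * y))))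
        ≡⟨ cong₂ (λ α β → y + (α * top-cost + β * (κ * y) + (y + (α * bottom-cost + β * (κ * y))))) ct cf ⟩
      y + (a * top-cost + s * (κ * y) + (y + (a * bottom-cost + s * (κ * y))))
        ≡⟨ lem₁ y a x h b κ′ s ⟩
      a * x + (2 + a * (5 + 2 * κ′) + 2 * a * (h + b) + 2 * s * κ) * y
        ≡⟨ cong (λ u → a * x + (2 + a * (5 + 2 * κ′) + 2 * a * u + 2 * s * κ) * y) h+b ⟩
      a * x + (2 + a * (5 + 2 * κ′) + 2 * a * (2 * s + 1) + 2 * s * κ) * y
        ≡⟨ lem₂ x y κ′ s ⟩
      a * x + (1 + a * (2 * κ′ + 4 * s + 8)) * y ∎
      where
      open ≡-Reasoning
      a = 2 * κ * s + 1
      lem₁ : ∀ y a x h b κ′ s →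
        y + (a * (1 * y + (h * y + (x + (h * y + (1 + κ′) * y)))) + s * ((3 + κ′) * y) +
          (y + (a * ((1 + κ′) * y + (b * y + (y + (b * y + 1 * y)))) + s * ((3 + κ′) * y))))
        ≡ a * x + (2 + a * (5 + 2 * κ′) + 2 * a * (h + b) + 2 * s * (3 + κ′)) * y
      lem₁ = solve-∀
      lem₂ : ∀ x y κ′ s →
        (2 * (3 + κ′) * s + 1) * x + (2 + (2 * (3 + κ′) * s + 1) * (5 + 2 * κ′) + 2 * (2 * (3 + κ′) * s + 1) * (2 * s + 1) + 2 * s * (3 + κ′)) * y
        ≡ (2 * (3 + κ′) * s + 1) * x + (1 + (2 * (3 + κ′) * s + 1) * (2 * κ′ + 4 * s + 8)) * y
      lem₂ = solve-∀

  boundary-length : ∀ fs → 1 ≤ length fs → 3 ≤ length (boundary fs)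
  boundary-length fs@(false ∷ _) _ = s≤s (s≤s (s≤s z≤n))
  boundary-length fs@(true ∷ fs′) _ = s≤s (s≤s (≤-trans (s≤s z≤n) (≤-reflexive (sym (length-++-suc
      ((up 1 (suc b) h ++ (hor 1 R , true) ∷ down 2 (suc b) h ++ right 2 (suc b) (1 + κ′)) ++ top fs′ 1))))))
    where
    length-++-suc : ∀ xs {d : GridDart} {ys} → length (xs ++ d ∷ ys) ≡ suc (length xs + length ys)
    length-++-suc xs = trans (length-++ xs) (+-suc _ _)

-- The construction

subset-values : ∀ {n} (S : Subset n) (f : Fin n → ℕ) → ∃[ ls ] (length ls ≡ ∣ S ∣ × (∀ i → i ∈ₛ S → f i ∈ ls))
subset-values [] f = [] , refl , λ ()
subset-values (true ∷ S) f with subset-values S (f ∘ suc)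
... | ls , eq , h = f zero ∷ ls , cong suc eq , λ where
  zero here → here refl
  (suc i) (there i∈) → there (h i i∈)
subset-values (false ∷ S) f with subset-values S (f ∘ suc)
... | ls , eq , h = ls , eq , λ where (suc i) (there i∈) → h i i∈

missing-value : ∀ {n} (ls : List ℕ) → length ls < n → ∃[ q ] (q < n × q ∉ˡ ls)
missing-value {n} ls short with Finₚ.any? {n = n} (λ i → ¬? (toℕ i ∈? ls))
... | yes (i , i∉) = toℕ i , Finₚ.toℕ<n i , i∉
... | no none = ⊥-elim (<-irrefl refl (<-≤-trans short
      (≤-trans (≤-reflexive (sym (length-upTo n))) (unique-⊆-length (Uniqueₚ.upTo⁺ n) (λ {v} v∈ → covered v (∈-upTo⁻ v∈))))))
  where
  covered : ∀ v → v < n → v ∈ ls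
  covered v v<n with v ∈? ls
  ... | yes v∈ = v∈
  ... | no v∉ = ⊥-elim (none (fromℕ< v<n , subst (_∉ˡ ls) (sym (Finₚ.toℕ-fromℕ< v<n)) v∉))

Marked-map : ∀ {U U′ : ℕ → Set} fs j → (∀ i → j ≤ i → U i → U′ i) → Marked U fs j → Marked U′ fs j
Marked-map [] j h _ = tt
Marked-map (f ∷ fs) j h (u , us) = h j ≤-refl ∘ u , Marked-map fs (suc j) (λ i j<i → h i (<⇒≤ j<i)) us

-- The choice is greedy. A forbidden index costs a unit but also leaves `ls`, so the bound persists.
-- Removing a single occurrence is enough, because all later indices exceed j.
choose-units : ∀ n j a ls → a + length ls ≤ n →
  ∃[ fs ] (length fs ≡ n × count true fs ≡ a × Marked (_∉ˡ ls) fs j)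
choose-units zero j zero ls _ = [] , refl , refl , tt
choose-units (suc n) j zero ls _ with choose-units n (suc j) zero [] z≤n
... | fs , l , c , _ = false ∷ fs , cong suc l , c , (λ ()) , unmarked fs c (suc j)
  where
  unmarked : ∀ fs → count true fs ≡ 0 → ∀ j → Marked (_∉ˡ ls) fs j
  unmarked [] _ j = tt
  unmarked (false ∷ fs) c j = (λ ()) , unmarked fs c (suc j)
choose-units (suc n) j (suc a) ls (s≤s le) with j ∈? ls
... | no j∉ = let (fs , l , c , us) = choose-units n (suc j) a ls le in
  true ∷ fs , cong suc l , cong suc c , (λ _ → j∉) , us
... | yes j∈ with ∈-∃++ j∈
... | as , bs , refl =
  let (fs , l , c , us) = choose-units n (suc j) (suc a) (as ++ bs) (≤-trans (≤-reflexive shorter) le) in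
  false ∷ fs , cong suc l , c , (λ ()) , Marked-map fs (suc j) avoids us
  where
  shorter : suc a + length (as ++ bs) ≡ a + length (as ++ j ∷ bs)
  shorter = trans (sym (+-suc a _)) (cong (a +_) (sym (trans (length-++ as) (trans (+-suc _ _) (cong suc (sym (length-++ as)))))))
  avoids : ∀ i → suc j ≤ i → i ∉ˡ as ++ bs → i ∉ˡ as ++ j ∷ bs
  avoids i j<i i∉ i∈ with ∈-++⁻ as i∈
  ... | inj₁ p = i∉ (∈-++⁺ˡ p)
  ... | inj₂ (here refl) = <-irrefl refl j<i
  ... | inj₂ (there p) = i∉ (∈-++⁺ʳ as p)

/-unique : ∀ {m n d} .{{_ : NonZero d}} → m * d ≤ n → n < suc m * d → n / d ≡ m
/-unique {m} {n} {d} lo hi = ≤-antisym (ℕ.s≤s⁻¹ (m<n*o⇒m/o<n hi))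
  (≤-trans (≤-reflexive (sym (m*n/n≡m m d))) (/-mono-≤ lo ≤-refl))

module Edges (κ M R : ℕ) where

  lights heavies edges : List GridEdge
  lights = cartesianProductWith ver (upTo (suc (M * κ))) (upTo R) ++ cartesianProductWith hor (upTo (M * κ)) (upTo R)
  heavies = map (λ j → hor (suc (j * κ)) R) (upTo M)
  edges = lights ++ heavies

  ver∈ : ∀ {c r} → c ≤ M * κ → r < R → ver c r ∈ edges
  ver∈ c≤ r< = ∈-++⁺ˡ (∈-++⁺ˡ (∈-cartesianProductWith⁺ ver (∈-upTo⁺ (s≤s c≤)) (∈-upTo⁺ r<)))

  hor∈ : ∀ {c r} → c < M * κ → r < R → hor c r ∈ edges
  hor∈ c< r< = ∈-++⁺ˡ (∈-++⁺ʳ (cartesianProductWith ver (upTo (suc (M * κ))) (upTo R))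
    (∈-cartesianProductWith⁺ hor (∈-upTo⁺ c<) (∈-upTo⁺ r<)))

  heavy∈ : ∀ {j} → j < M → hor (suc (j * κ)) R ∈ edges
  heavy∈ j< = ∈-++⁺ʳ lights (∈-map⁺ _ (∈-upTo⁺ j<))

  data Light : GridEdge → Set where
    light-ver : ∀ {c r} → Light (ver c r)
    light-hor : ∀ {c r} → r < R → Light (hor c r)

  lights-light : All Light lights
  lights-light = Allₚ.++⁺
    (All.tabulate (λ e∈ → case ∈-cartesianProductWith⁻ ver (upTo (suc (M * κ))) (upTo R) e∈ of λ where
      (c , r , _ , _ , refl) → light-ver))
    (All.tabulate (λ e∈ → case ∈-cartesianProductWith⁻ hor (upTo (M * κ)) (upTo R) e∈ of λ where
      (c , r , _ , r∈ , refl) → light-hor (∈-upTo⁻ r∈)))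

  length-heavies : length heavies ≡ M
  length-heavies = trans (length-map _ (upTo M)) (length-upTo M)

  edges-unique : .{{_ : NonZero κ}} → Unique edges
  edges-unique = Uniqueₚ.++⁺
    (Uniqueₚ.++⁺
      (Uniqueₚ.cartesianProductWith⁺ ver (λ { refl → refl , refl }) (Uniqueₚ.upTo⁺ (suc (M * κ))) (Uniqueₚ.upTo⁺ R))
      (Uniqueₚ.cartesianProductWith⁺ hor (λ { refl → refl , refl }) (Uniqueₚ.upTo⁺ (M * κ)) (Uniqueₚ.upTo⁺ R))
      (λ { (p , q) → ver≢hor p q }))
    (Uniqueₚ.map⁺ (λ eq → *-cancelʳ-≡ _ _ κ (suc-injective (column-injective eq))) (Uniqueₚ.upTo⁺ M))
    (λ { (p , q) → light≢heavy p q })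
    where
    column-injective : ∀ {c c′ r r′} → hor c r ≡ hor c′ r′ → c ≡ c′
    column-injective refl = refl
    ver≢hor : ∀ {e} → e ∈ cartesianProductWith ver (upTo (suc (M * κ))) (upTo R) →
      e ∈ cartesianProductWith hor (upTo (M * κ)) (upTo R) → ⊥
    ver≢hor p q with ∈-cartesianProductWith⁻ ver (upTo (suc (M * κ))) (upTo R) p
                   | ∈-cartesianProductWith⁻ hor (upTo (M * κ)) (upTo R) q
    ... | _ , _ , _ , _ , refl | _ , _ , _ , _ , ()
    light≢heavy : ∀ {e} → e ∈ lights → e ∈ heavies → ⊥
    light≢heavy p q with ∈-map⁻ (λ j → hor (suc (j * κ)) R) q | All.lookup lights-light p
    ... | _ , _ , refl | light-hor r<R = <-irrefl refl r<R

sum-filter : ∀ {A : Set} {P : A → Set} (P? : Decidable P) (w : A → ℕ) k {xs} → All (λ e → w e ≡ k) xs →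
  sum (map w (filter P? xs)) ≡ length (filter P? xs) * k
sum-filter P? w k [] = refl
sum-filter P? w k {x ∷ xs} (eq ∷ eqs) with does (P? x)
... | true = cong₂ _+_ eq (sum-filter P? w k eqs)
... | false = sum-filter P? w k eqs

length-concatMap : ∀ {A B : Set} (f : A → List B) (xs : List A) → length (concatMap f xs) ≡ sum (map (length ∘ f) xs)
length-concatMap f [] = refl
length-concatMap f (x ∷ xs) = trans (length-++ (f x)) (cong (length (f x) +_) (length-concatMap f xs))

sum-constant : ∀ {A : Set} (w : A → ℕ) k {xs} → All (λ e → w e ≡ k) xs → sum (map w xs) ≡ length xs * k
sum-constant w k [] = refl
sum-constant w k (eq ∷ eqs) = cong₂ _+_ eq (sum-constant w k eqs)

module Construction (t s x y : ℕ) {{x≢0 : NonZero x}} {{y≢0 : NonZero y}} where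

  κ a M R N : ℕ
  -- The 3 is the room needed inside a unit; the t makes a larger than t s.
  κ = 3 + t
  a = 2 * κ * s + 1
  M = a + s
  -- Rows 0 to 2 s + 1 carry the s + 1 disjoint strips, and one further row is reserved for the
  -- heavy edges.
  R = 2 * s + 2
  -- A common multiple of both subdivision numbers, so that all cut points are integral.
  N = x * y

  instance
    N≢0 : NonZero N
    N≢0 = m*n≢0 x y

  pieces gap : ℕ → ℕ
  pieces r = if does (r ℕ.≟ R) then x else y
  gap r = if does (r ℕ.≟ R) then y else x

  pieces*gap : ∀ r → pieces r * gap r ≡ N
  pieces*gap r with does (r ℕ.≟ R)
  ... | true = refl
  ... | false = *-comm y x

  pieces-R : pieces R ≡ x
  pieces-R = cong (λ b → if b then x else y) (dec-true (R ℕ.≟ R) refl)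

  pieces-< : ∀ {r} → r < R → pieces r ≡ y
  pieces-< {r} r<R = cong (λ b → if b then x else y) (dec-false (r ℕ.≟ R) (<⇒≢ r<R))

  open Edges κ M R

  open SubdividedGrid N x y (*-comm y x) pieces gap pieces*gap
    using (w; vtx; w≥1; gap-nonZero; x-nonZero; column-scale; row-scale; module Drawn)
  open Drawn edges edges-unique
    using (graph; planar; pt; vs; vs₀; dstart; dend; closed-walk⇒cycle; module CycleEdges)

  m₁ : ℕ
  m₁ = length lights

  lights-y : All (λ e → w e ≡ y) lights
  lights-y = All.map (λ { light-ver → refl ; (light-hor r<R) → pieces-< r<R }) lights-light

  heavies-x : All (λ e → w e ≡ x) heavies
  heavies-x = All.tabulate (λ e∈ → case ∈-map⁻ (λ j → hor (suc (j * κ)) R) e∈ of λ where (_ , _ , refl) → pieces-R)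

  -- α and β count the heavy and light edges used. Their bounds depend on t and s but not on x and
  -- y, so they can be fixed before the edge lengths are chosen.
  cycle-length : ∀ (C : Cycle graph) → ∃[ α ] ∃[ β ] (α ≤ M × β ≤ m₁ × Cycle.len C ≡ α * x + β * y)
  cycle-length C = length (filter used′ heavies) , length (filter used′ lights) ,
    ≤-trans (length-filter used′ heavies) (≤-reflexive length-heavies) , length-filter used′ lights , (begin
      Cycle.len C                                                                  ≡⟨ length-as-sum ⟩
      sum (map w (filter used′ (lights ++ heavies)))                               ≡⟨ cong (sum ∘ map w) (filter-++ used′ lights heavies) ⟩
      sum (map w (filter used′ lights ++ filter used′ heavies))                    ≡⟨ cong sum (map-++ w (filter used′ lights) _) ⟩
      sum (map w (filter used′ lights) ++ map w (filter used′ heavies))            ≡⟨ sum-++ (map w (filter used′ lights)) _ ⟩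
      sum (map w (filter used′ lights)) + sum (map w (filter used′ heavies))
        ≡⟨ cong₂ _+_ (sum-filter used′ w y lights-y) (sum-filter used′ w x heavies-x) ⟩
      length (filter used′ lights) * y + length (filter used′ heavies) * x         ≡⟨ +-comm (length (filter used′ lights) * y) _ ⟩
      length (filter used′ heavies) * x + length (filter used′ lights) * y         ∎)
    where
    open ≡-Reasoning
    open CycleEdges C
    used′ = λ e → used? (e , 0)

  -- Each edge contributes both its ends, so corners are counted repeatedly. The excess is at most
  -- `m₁ + M`, which is negligible against x.
  order-bound : Graph.n graph ≤ m₁ * suc y + M * suc x
  order-bound = begin
    length vs                         ≤⟨ unique-⊆-length vs-unique (∈-deduplicate⁻ _≟P_ vs₀) ⟩
    length vs₀                        ≡⟨ length-concatMap (λ e → map (vtx e) (upTo (suc (w e)))) edges ⟩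
    sum (map points edges)            ≡⟨ cong sum (map-++ points lights heavies) ⟩
    sum (map points lights ++ map points heavies)        ≡⟨ sum-++ (map points lights) _ ⟩
    sum (map points lights) + sum (map points heavies)
      ≡⟨ cong₂ _+_ (sum-constant points (suc y) (All.map (λ {e} → points≡ e) lights-y))
                   (sum-constant points (suc x) (All.map (λ {e} → points≡ e) heavies-x)) ⟩
    m₁ * suc y + length heavies * suc x     ≡⟨ cong (λ u → m₁ * suc y + u * suc x) length-heavies ⟩
    m₁ * suc y + M * suc x            ∎
    where
    open ≤-Reasoning
    points : GridEdge → ℕ
    points e = length (map (vtx e) (upTo (suc (w e))))
    points≡ : ∀ e {k} → w e ≡ k → points e ≡ suc k
    points≡ e refl = trans (length-map (vtx e) (upTo (suc (w e)))) (length-upTo (suc (w e)))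
    vs-unique : Unique vs
    vs-unique = deduplicate-! _≟P_ vs₀

  -- Cycles avoiding a deleted set

  corner : ℕ × ℕ → ℕ × ℕ
  corner (c , r) = c * N , r * N

  dstart-corner : ∀ d → dstart d ≡ corner (from d)
  dstart-corner (hor c r , true) = cong (_, r * N) (trans (cong (_* gap r) (+-identityʳ (c * pieces r))) (sym (column-scale c r)))
  dstart-corner (hor c r , false) = cong (_, r * N) (trans (cong (_* gap r) (+-comm (c * pieces r) (pieces r))) (sym (column-scale (suc c) r)))
  dstart-corner (ver c r , true) = cong (c * N ,_) (trans (cong (_* x) (+-identityʳ (r * y))) (sym (row-scale r)))
  dstart-corner (ver c r , false) = cong (c * N ,_) (trans (cong (_* x) (+-comm (r * y) y)) (sym (row-scale (suc r))))

  corner-injective : ∀ {u v} → corner u ≡ corner v → u ≡ v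
  corner-injective {c , r} {c′ , r′} eq = cong₂ _,_ (*-cancelʳ-≡ c c′ N (cong proj₁ eq)) (*-cancelʳ-≡ r r′ N (cong proj₂ eq))

  corner-walk : ∀ {u ds v} → Walk u ds v → Walks.Walk dstart dend (corner u) ds (corner v)
  corner-walk [] = Walks.[]
  corner-walk {v = v} (step {ds = ds} d refl p) = Walks.step d (dstart-corner d)
    (subst (λ z → Walks.Walk dstart dend z ds (corner v)) (sym (dend-corner d)) (corner-walk p))
    where
    dend-corner : ∀ d → dend d ≡ corner (to d)
    dend-corner (e , true) = dstart-corner (e , false)
    dend-corner (e , false) = dstart-corner (e , true)

  instance
    κN≢0 : NonZero (κ * N)
    κN≢0 = m*n≢0 κ N
    2N≢0 : NonZero (2 * N)
    2N≢0 = m*n≢0 2 N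

  -- Floor division assigns each vertex one strip and one unit, so a deleted vertex spoils at most
  -- one of each. The value q of `ring` covers heights from 2q N up to, but excluding, (2q + 2) N,
  -- and so both rows of strip q.
  ring unit : ℕ × ℕ → ℕ
  ring (X , Y) = Y / (2 * N)
  unit (X , Y) = X / (κ * N)

  within : ∀ e k → k ≤ w e → let (c , r) = from (e , true) ; (c′ , r′) = from (e , false) ; (X , Y) = vtx e k in
    (c * N ≤ X × X ≤ c′ * N) × (r * N ≤ Y × Y ≤ r′ * N)
  within (hor c r) k k≤ =
    (≤-trans (≤-reflexive (column-scale c r)) (*-monoˡ-≤ (gap r) (m≤m+n (c * pieces r) k)) ,
     ≤-trans (*-monoˡ-≤ (gap r) (≤-trans (+-monoʳ-≤ (c * pieces r) k≤) (≤-reflexive (+-comm (c * pieces r) (pieces r))))) (≤-reflexive (sym (column-scale (suc c) r)))) ,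
    (≤-refl , ≤-refl)
  within (ver c r) k k≤ = (≤-refl , ≤-refl) ,
    (≤-trans (≤-reflexive (row-scale r)) (*-monoˡ-≤ x (m≤m+n (r * y) k)) ,
     ≤-trans (*-monoˡ-≤ x (≤-trans (+-monoʳ-≤ (r * y) k≤) (≤-reflexive (+-comm (r * y) y)))) (≤-reflexive (sym (row-scale (suc r)))))

  ring-≡ : ∀ {q X Y} → 2 * q * N ≤ Y → Y ≤ suc (2 * q) * N → ring (X , Y) ≡ q
  ring-≡ {q} lo hi = /-unique (≤-trans (≤-reflexive (lem q N)) lo)
    (<-≤-trans (≤-<-trans hi (*-monoˡ-< N (n<1+n (suc (2 * q))))) (≤-reflexive (lem′ q N)))
    where
    lem : ∀ q N → q * (2 * N) ≡ 2 * q * N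
    lem = solve-∀
    lem′ : ∀ q N → suc (suc (2 * q)) * N ≡ suc q * (2 * N)
    lem′ = solve-∀

  unit-≡ : ∀ {j c c′ X Y} → j * κ ≤ c → c′ < suc j * κ → c * N ≤ X → X ≤ c′ * N → unit (X , Y) ≡ j
  unit-≡ {j} {c} {c′} lo hi cX Xc′ = /-unique
    (≤-trans (≤-trans (≤-reflexive (sym (*-assoc j κ N))) (*-monoˡ-≤ N lo)) cX)
    (<-≤-trans (≤-<-trans Xc′ (*-monoˡ-< N hi)) (≤-reflexive (*-assoc (suc j) κ N)))

  module StripAt (q : ℕ) (q≤s : q ≤ s) (U : ℕ → Set) where

    b h : ℕ
    b = 2 * q
    -- The distance from row 2q + 1 up to row R.
    h = 2 * (s ∸ q) + 1

    open Strip t h b using (boundary; boundary-walk; boundary-distinct; boundary-good; boundary-length; total-boundary;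
      BoundaryEdge; strip-hor; strip-ver; unit-hor; unit-ver; heavy) renaming (R to R′)

    h+b : h + b ≡ 2 * s + 1
    h+b = trans (lem (s ∸ q) q) (cong (λ u → 2 * u + 1) (m∸n+n≡m q≤s))
      where
      lem : ∀ d q → 2 * d + 1 + 2 * q ≡ 2 * (d + q) + 1
      lem = solve-∀

    R′≡R : R′ ≡ R
    R′≡R = trans (+-suc h b) (trans (cong suc h+b) (sym (+-suc (2 * s) 1)))

    b<R : suc b < R′
    b<R = m<n+m (suc b) (≤-trans (s≤s z≤n) (m≤n+m 1 (2 * (s ∸ q))))

    edge∈ : ∀ {e} → BoundaryEdge U M b<R e → e ∈ edges
    edge∈ (strip-hor c< (inj₁ refl)) = hor∈ c< (subst (b <_) R′≡R (<⇒≤ b<R))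
    edge∈ (strip-hor c< (inj₂ refl)) = hor∈ c< (subst (suc b <_) R′≡R b<R)
    edge∈ (strip-ver c≤) = ver∈ c≤ (subst (b <_) R′≡R (<⇒≤ b<R))
    edge∈ (unit-hor {j} {r = r} _ j< r< _ c<) = hor∈ (<-≤-trans (<⇒≤ c<) (*-monoˡ-≤ κ j<)) (subst (r <_) R′≡R r<)
    edge∈ (unit-ver {j} {r = r} _ j< r< _ c<) = ver∈ (≤-trans (<⇒≤ c<) (*-monoˡ-≤ κ j<)) (subst (r <_) R′≡R r<)
    edge∈ (heavy {j} _ j<) = subst (λ r → hor (suc (j * κ)) r ∈ edges) (sym R′≡R) (heavy∈ j<)

    located : ∀ {e} → BoundaryEdge U M b<R e → ∀ k → k ≤ w e → ring (vtx e k) ≡ q ⊎ ∃[ j ] (U j × unit (vtx e k) ≡ j)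
    located {e} (strip-hor {c} c< (inj₁ refl)) k k≤ = inj₁ (ring-≡ {X = proj₁ (vtx e k)} ≤-refl (*-monoˡ-≤ N (n≤1+n b)))
    located {e} (strip-hor {c} c< (inj₂ refl)) k k≤ = inj₁ (ring-≡ {X = proj₁ (vtx e k)} (*-monoˡ-≤ N (n≤1+n b)) ≤-refl)
    located {e} (strip-ver c≤) k k≤ = let (_ , lo , hi) = within e k k≤ in inj₁ (ring-≡ {X = proj₁ (vtx e k)} lo hi)
    located {e} (unit-hor {j} u _ _ lo hi) k k≤ = let ((lo′ , hi′) , _) = within e k k≤ in
      inj₂ (j , u , unit-≡ {Y = proj₂ (vtx e k)} lo hi lo′ hi′)
    located {e} (unit-ver {j} u _ _ lo hi) k k≤ = let ((lo′ , hi′) , _) = within e k k≤ in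
      inj₂ (j , u , unit-≡ {Y = proj₂ (vtx e k)} lo hi lo′ hi′)
    located {e} (heavy {j} u _) k k≤ = let ((lo′ , hi′) , _) = within e k k≤ in
      inj₂ (j , u , unit-≡ {Y = proj₂ (vtx e k)} (n≤1+n _) (s≤s (s≤s (s≤s (m≤n+m (j * κ) t)))) lo′ hi′)

    cycle : ∀ fs → length fs ≡ M → count true fs ≡ a → Marked U fs 0 →
      Σ (Cycle graph) λ C → Cycle.len C ≡ a * x + (1 + a * (2 * t + 4 * s + 8)) * y ×
        (∀ i → ring (pt (Cycle.vert C i)) ≡ q ⊎ ∃[ j ] (U j × unit (pt (Cycle.vert C i)) ≡ j))
    cycle fs len≡ ct us =
      let (C , len , cov) = closed-walk⇒cycle w≥1 (corner-walk (boundary-walk fs))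
            (All.map edge∈ good)
            (AllPairs.map (λ {d} {d′} ne eq → ne (corner-injective (trans (sym (dstart-corner d)) (trans eq (dstart-corner d′)))))
              (boundary-distinct fs))
            (boundary-length fs (subst (1 ≤_) (sym len≡) (≤-trans (m≤n+m 1 (2 * κ * s)) (m≤m+n a s))))
      in C ,
         trans len (total-boundary w x y (λ _ _ → refl) (λ c r r< → pieces-< (subst (r <_) R′≡R r<))
           (λ c → trans (cong pieces R′≡R) pieces-R) b<R fs s h+b ct
           (+-cancelˡ-≡ a _ _ (trans (cong (_+ count false fs) (sym ct)) (trans (count-total fs) len≡)))) ,
         λ i → let (d , k , d∈ , k≤ , eq) = cov i in
           subst (λ p → ring p ≡ q ⊎ ∃[ j ] (U j × unit p ≡ j)) (sym eq) (located (All.lookup good d∈) k k≤)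
      where
      good : All (λ d → BoundaryEdge U M b<R (proj₁ d)) (boundary fs)
      good = boundary-good U M b<R fs len≡ us

  avoiding-cycle : ∀ (S : Subset (Graph.n graph)) → ∣ S ∣ ≤ s →
    Σ (Cycle graph) λ C → Cycle.len C ≡ a * x + (1 + a * (2 * t + 4 * s + 8)) * y × (∀ i → Cycle.vert C i ∉ S)
  avoiding-cycle S S≤s =
    let (ls , ls≡ , ls-hit) = subset-values S (ring ∘ pt)
        (ls′ , ls′≡ , ls′-hit) = subset-values S (unit ∘ pt)
        (q , q<1+s , q∉) = missing-value {suc s} ls (s≤s (≤-trans (≤-reflexive ls≡) S≤s))
        (fs , len≡ , ct , us) = choose-units M 0 a ls′ (+-monoʳ-≤ a (≤-trans (≤-reflexive ls′≡) S≤s))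
        (C , len , loc) = StripAt.cycle q (ℕ.s≤s⁻¹ q<1+s) (_∉ˡ ls′) fs len≡ ct us
    in C , len , λ i i∈ → case loc i of λ where
      (inj₁ eq) → q∉ (subst (_∈ ls) eq (ls-hit _ i∈))
      (inj₂ (j , j∉ , eq)) → j∉ (subst (_∈ ls′) eq (ls′-hit _ i∈))

  -- Vertices missed by long cycles

  module _ (L : ℕ → Set) (ℓ : ℕ) (Lℓ : L ℓ) (ℓ≡ : a * x + (1 + a * (2 * t + 4 * s + 8)) * y ≡ ℓ)
    (y-small : (t * (2 * m₁ + M) + 1) * y ≤ x)
    (sparse : ∀ α β → α ≤ M → β ≤ m₁ → 0 < α * x + β * y → α * x + β * y < ℓ → ¬ L (α * x + β * y)) where

    L-cycles-long : ∀ (C : LCycle graph L) → ℓ ≤ Cycle.len (proj₁ C)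
    L-cycles-long (C , l) =
      let (α , β , α≤ , β≤ , eq) = cycle-length C in
      ≮⇒≥ λ short → sparse α β α≤ β≤ (subst (0 <_) eq (≤-trans (s≤s z≤n) (Cycle.len≥3 C))) (subst (_< ℓ) eq short) (subst L eq l)

    -- Of the heavy vertices, ℓ accounts for a x and leaves s x. Since a x = x + (6 + 2 t) s x,
    -- there is room for t s x and for a spare x. By `y-small` the spare x covers the light terms:
    -- constants are multiplied by y ≥ 1, whence 2 m₁ + M, and the extra y makes the inequality
    -- strict.
    few-missed : t * (Graph.n graph ∸ ℓ) < ℓ
    few-missed = begin-strict
      t * (Graph.n graph ∸ ℓ)                          ≤⟨ *-monoʳ-≤ t (m≤n+o⇒m∸n≤o _ ℓ (begin
        Graph.n graph                                  ≤⟨ order-bound ⟩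
        m₁ * suc y + M * suc x                         ≡⟨ lem₁ m₁ y a s x ⟩
        a * x + (m₁ + m₁ * y + M + s * x)              ≤⟨ +-monoˡ-≤ _ (≤-trans (m≤m+n (a * x) _) (≤-reflexive ℓ≡)) ⟩
        ℓ + (m₁ + m₁ * y + M + s * x)                  ∎)) ⟩
      t * (m₁ + m₁ * y + M + s * x)                    ≡⟨ lem₂ t m₁ y M s x ⟩
      t * (m₁ + M) * 1 + t * m₁ * y + t * s * x        ≤⟨ +-monoˡ-≤ (t * s * x) (+-monoˡ-≤ (t * m₁ * y) (*-monoʳ-≤ (t * (m₁ + M)) (ℕ.>-nonZero⁻¹ y))) ⟩
      t * (m₁ + M) * y + t * m₁ * y + t * s * x        ≡⟨ lem₃ t m₁ y M s x ⟩
      t * (2 * m₁ + M) * y + 0 + t * s * x             <⟨ +-monoˡ-< (t * s * x) (+-monoʳ-< (t * (2 * m₁ + M) * y) (ℕ.>-nonZero⁻¹ y)) ⟩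
      t * (2 * m₁ + M) * y + y + t * s * x             ≡⟨ cong (_+ t * s * x) (lem₄ (t * (2 * m₁ + M)) y) ⟩
      (t * (2 * m₁ + M) + 1) * y + t * s * x           ≤⟨ +-monoˡ-≤ (t * s * x) y-small ⟩
      x + t * s * x                                    ≤⟨ m≤m+n _ ((6 + t) * s * x) ⟩
      x + t * s * x + (6 + t) * s * x                  ≡⟨ lem₅ t s x ⟩
      a * x                                            ≤⟨ m≤m+n (a * x) _ ⟩
      a * x + (1 + a * (2 * t + 4 * s + 8)) * y        ≡⟨ ℓ≡ ⟩
      ℓ                                                ∎
      where
      open ≤-Reasoning
      lem₁ : ∀ m₁ y a s x → m₁ * suc y + (a + s) * suc x ≡ a * x + (m₁ + m₁ * y + (a + s) + s * x)
      lem₁ = solve-∀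
      lem₂ : ∀ t m₁ y M s x → t * (m₁ + m₁ * y + M + s * x) ≡ t * (m₁ + M) * 1 + t * m₁ * y + t * s * x
      lem₂ = solve-∀
      lem₃ : ∀ t m₁ y M s x → t * (m₁ + M) * y + t * m₁ * y + t * s * x ≡ t * (2 * m₁ + M) * y + 0 + t * s * x
      lem₃ = solve-∀
      lem₄ : ∀ u y → u * y + y ≡ (u + 1) * y
      lem₄ = solve-∀
      lem₅ : ∀ t s x → x + t * s * x + (6 + t) * s * x ≡ (2 * (3 + t) * s + 1) * x
      lem₅ = solve-∀

    -- The cycle that avoids the empty set already has ℓ distinct vertices. This turns the bound by
    -- ℓ into the bound by the order that `common-value` asks for.
    ℓ≤order : ℓ ≤ Graph.n graph
    ℓ≤order =
      let (C , len , _) = avoiding-cycle ∅ (≤-trans (≤-reflexive (∣⊥∣≡0 (Graph.n graph))) z≤n) in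
      ≤-trans (≤-reflexive (trans (sym ℓ≡) (sym len))) (Finₚ.injective⇒≤ (λ {i} {j} → Cycle.inj C i j))

    unavoidable-cycles : Planar graph ×
      ((C : Fin t → LCycle graph L) → ∃[ v ] (∀ i → OnCycle graph v (proj₁ (C i)))) ×
      ((S : Subset (Graph.n graph)) → ∣ S ∣ ≤ s → Σ (LCycle graph L) λ C → ∀ i → Cycle.vert {graph} (proj₁ C) i ∉ S)
    unavoidable-cycles = planar ,
      (λ C → common-value (λ i → Cycle.len (proj₁ (C i))) (λ i → Cycle.vert (proj₁ (C i))) (λ i → Cycle.inj (proj₁ (C i)))
        (L-cycles-long ∘ C) (<-≤-trans few-missed ℓ≤order)) ,
      λ S S≤s → let (C , len , avoid) = avoiding-cycle S S≤s in (C , subst L (sym (trans len ℓ≡)) Lℓ) , avoid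

theorem2p2 : (L : ℕ → Set) → (∀ {m} → L m → 1 ≤ m) → Infinite L → LowerDensityZero L →
    (t s : ℕ) → Σ Graph λ G → Planar G ×
    ((C : Fin t → LCycle G L) → ∃[ v ] (∀ i → OnCycle G v (proj₁ (C i)))) ×
    ((S : Subset (Graph.n G)) → ∣ S ∣ ≤ s →
    Σ (LCycle G L) λ C → ∀ i → Cycle.vert {G} (proj₁ C) i ∉ S)
theorem2p2 L pos inf ldz t s =
  let κ = 3 + t
      a = 2 * κ * s + 1
      M = a + s
      m₁ = length (Edges.lights κ M (2 * s + 2))
      -- The thresholds depend on t and s only; ℓ is picked afterwards, and x and y last.
      (q , N , choose) = choose-lengths a (2 * t + 4 * s + 8) (t * (2 * m₁ + M) + 1) M m₁
        {{>-nonZero (m≤n+m 1 (2 * κ * s))}}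
      (ℓ , Lℓ , N≤ℓ , ls , few , ls-all) = sparse-element pos inf ldz q N
      (x , y , 2≤x , 2≤y , y-small , ℓ≡ , sparse) = choose ℓ ls N≤ℓ few
  in _ , Construction.unavoidable-cycles t s x y {{>-nonZero (<⇒≤ 2≤x)}} {{>-nonZero (<⇒≤ 2≤y)}} L ℓ Lℓ ℓ≡ y-small
           (λ α β α≤ β≤ 0< <ℓ l → sparse α β α≤ β≤ 0< <ℓ (ls-all _ <ℓ l))
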